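{- For every positive integer $k$ and every prime $p\ge 5$, $[C_{p^k}]=\{C_{p^k},D_{p^k}\}$.
   Context: All graphs are finite, undirected and simple, considered up to isomorphism. The independence polynomial of a graph $G$ is $i(G,x)=\sum_{j\ge 0} i_j x^j$, where $i_j$ is the number of independent sets (vertex sets inducing no edges) of size $j$. The independence equivalence class $[G]$ is the set of graphs $H$ with $i(H,x)=i(G,x)$. $C_n$ is the cycle on $n$ vertices, and for $n\ge 3$, $D_n$ is the graph on vertices $u_1,\dots,u_n$ with edges $u_1u_2,u_1u_3,u_2u_3$ and $u_ju_{j+1}$ for $3\le j\le n-1$. -}

module Defs where

open import Data.Nat using (ℕ; zero; suc; _∸_; _≡ᵇ_; _+_)
open import Data.Bool using (Bool; true; false; _∧_; _∨_; not; if_then_else_; _≟_)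
open import Data.Fin using (Fin; toℕ)
open import Data.List using (List; []; _∷_; map; _++_; filter; length; allFin)
open import Data.Vec using (Vec; []; _∷_; lookup)
open import Data.Product using (Σ; _×_; _,_)
open import Data.Sum using (_⊎_)
open import Relation.Binary.PropositionalEquality using (_≡_)
open import Function.Definitions using (Bijective)

Graph : ℕ → Set
Graph n = Fin n → Fin n → Bool

IsSimpleGraph : ∀ {n} → Graph n → Set
IsSimpleGraph {n} G = (∀ i j → G i j ≡ G j i) × (∀ i → G i i ≡ false)

_≅_ : ∀ {m n} → Graph m → Graph n → Set
_≅_ {m} {n} H G =
  Σ (Fin m → Fin n) λ f → Bijective _≡_ _≡_ f × (∀ i j → H i j ≡ G (f i) (f j))

subsets : (n : ℕ) → List (Vec Bool n)
subsets zero = [] ∷ []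
subsets (suc n) = map (true ∷_) (subsets n) ++ map (false ∷_) (subsets n)

size : ∀ {n} → Vec Bool n → ℕ
size [] = 0
size (b ∷ v) = (if b then 1 else 0) + size v

all : ∀ {A : Set} → (A → Bool) → List A → Bool
all f [] = true
all f (x ∷ xs) = f x ∧ all f xs

isIndependent : ∀ {n} → Graph n → Vec Bool n → Bool
isIndependent {n} G S =
  all (λ i → all (λ j → not (lookup S i ∧ lookup S j ∧ G i j)) (allFin n)) (allFin n)

indepCoeff : ∀ {n} → Graph n → ℕ → ℕ
indepCoeff {n} G j =
  length (filter (λ S → isIndependent G S ∧ (size S ≡ᵇ j) ≟ true) (subsets n))

SameIndPoly : ∀ {m n} → Graph m → Graph n → Set
SameIndPoly H G = ∀ j → indepCoeff H j ≡ indepCoeff G j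

symAdj : (ℕ → ℕ → Bool) → ∀ {n} → Graph n
symAdj r i j = r (toℕ i) (toℕ j) ∨ r (toℕ j) (toℕ i)

C : (n : ℕ) → Graph n
C n = symAdj (λ a b → (suc a ≡ᵇ b) ∨ ((a ≡ᵇ 0) ∧ (b ≡ᵇ n ∸ 1)))

-- D_n with u_i ↦ i-1: edges u1u2,u1u3,u2u3 and u_j u_{j+1} (3≤j≤n-1),
-- i.e. the path 0-1-…-(n-1) plus the edge 0-2.
D : (n : ℕ) → Graph n
D n = symAdj (λ a b → (suc a ≡ᵇ b) ∨ ((a ≡ᵇ 0) ∧ (b ≡ᵇ 2)))

{-# OPTIONS --safe #-}
module Submission where

-- Write n = p^k. Since i(C_n, x) is a Lucas-type polynomial, every coefficient past the constant
-- term satisfies j i_j = n (path coefficient), hence is divisible by p; so i(C_n, x) = 1 mod p. If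
-- H is equivalent to C_n, then every component A of H therefore has i(A, x) = 1 mod p, and comparing
-- the first two coefficients p divides both the number of vertices and the number of edges of A.
-- In particular A is not a tree, and since H has n vertices and n edges all components are
-- unicyclic. The third coefficient says that the sum of C(d-1, 2) over the vertex degrees d equals
-- the number of triangles. A unicyclic component has at most one triangle and is not a triangle
-- itself (p does not divide 3), so this equality holds in each component separately; it forces
-- each component to be a cycle, or a triangle with a path attached to it, i.e. some C_a or D_a.
-- Finally 2^a i(C_a, -1/4) = 2^a i(D_a, -1/4) = 2, so multiplicativity at x = -1/4 shows that
-- there is only one component.

open import Defs
open import Data.Bool using (Bool; true; false; _∧_; _∨_; not; if_then_else_)
import Data.Bool as Bool
open import Data.Bool.Properties using (∧-zeroʳ; ∧-identityʳ; ∧-assoc; ∧-comm; ∨-comm; ∨-zeroʳ; ¬-not; ⇔→≡)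
open import Data.Empty using (⊥-elim)
open import Data.Fin using (Fin; zero; suc; toℕ; fromℕ<)
open import Data.Fin.Properties using (toℕ-injective; toℕ<n; toℕ-fromℕ<)
open import Data.Integer as ℤ using (ℤ) renaming (+_ to pos)
import Data.Integer.Properties as ℤ
import Data.Integer.Tactic.RingSolver as ℤRing
open import Data.List using (List; []; _∷_; _++_; [_]; length; concat; map; filter; allFin; tabulate; downFrom; applyDownFrom)
open import Data.List.Properties using (length-++; ++-identityʳ; downFrom-∷ʳ; length-downFrom)
open import Data.List.Membership.Propositional using (_∈_; find; lose)
open import Data.List.Membership.Propositional.Properties
  using (∈-++⁺ˡ; ∈-++⁻; ∈-map⁺; ∈-map⁻; ∈-allFin; ∈-downFrom⁺; ∈-downFrom⁻; ∈-applyDownFrom⁻)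
open import Data.List.Relation.Binary.Permutation.Propositional
  using (_↭_; refl; prep; swap; trans; ↭-sym; ↭-trans; ↭-reflexive; ↭⇒↭ₛ)
open import Data.List.Relation.Binary.Permutation.Propositional.Properties
  using (∈-resp-↭; ↭-length; shift; drop-∷; ++⁺ˡ; ++⁺ʳ; ∷↭∷ʳ)
import Data.List.Relation.Binary.Permutation.Setoid.Properties as Permₛ
open import Data.List.Relation.Unary.All using (All; []; _∷_)
import Data.List.Relation.Unary.All as All
open import Data.List.Relation.Unary.Any using (here; there; any?)
open import Data.List.Relation.Unary.Unique.Propositional using (Unique; []; _∷_)
import Data.List.Relation.Unary.Unique.Propositional.Properties as Uniqueₚ
open import Data.Nat
open import Data.Nat.Divisibility
open import Data.Nat.Primality using (Prime; euclidsLemma; prime⇒nonZero; prime⇒nonTrivial)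
open import Data.Nat.Properties
open import Data.Nat.Tactic.RingSolver using (solve-∀)
open import Data.Product using (∃; ∃₂; _×_; _,_; proj₁; proj₂)
open import Data.Sum using (_⊎_; inj₁; inj₂)
open import Data.Unit using (⊤; tt)
open import Data.Vec using (Vec; []; _∷_; lookup)
open import Function using (_∘_; case_of_)
open import Function.Bundles using (_⇔_; mk⇔)
open import Function.Definitions using (Bijective)
open import Relation.Binary.Definitions using (tri<; tri≈; tri>)
open import Relation.Binary.PropositionalEquality hiding ([_]; trans) renaming (refl to ≡-refl)
import Relation.Binary.PropositionalEquality as ≡
open import Relation.Nullary using (¬_; yes; no)

-- Divisibility passes from a disjoint union to its components because F_p[x] is an integral domain:
-- if a product of polynomials with constant term 1 is 1 modulo p, both factors have degree 0 modulo
-- p. The congruences and the first three coefficients cannot exclude several components: for n =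
-- 125, five copies of C_25 satisfy all of these conditions. Hence the evaluation at -1/4. As i(C_n,
-- x) is the sum of the n-th powers of the two roots of t^2 = t + x, a point where the roots
-- coincide is wanted; at -1/4 both are 1/2. Up to a power of 2 fixed by its number of vertices,
-- each cycle or tadpole then contributes a factor 2, so the value counts components. Induced
-- subgraphs are kept as a vertex list with a Boolean predicate: the list carries the recursion and
-- matters only up to permutation, while choosing a vertex strengthens the predicate. Counting
-- identities have their negative terms moved across and stay in ℕ; only the alternating value at
-- -1/4 lives in ℤ.

module PrimePowers {p} (p-prime : Prime p) where

  ∤1 : ¬ (p ∣ 1)
  ∤1 p∣1 = <-irrefl (sym (∣1⇒≡1 p∣1)) (nonTrivial⇒n>1 p {{prime⇒nonTrivial p-prime}})

  -- Factors p are peeled off `a` one at a time until p divides `c` or all k are found in `a`. It is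
  -- applied with `a` the index j and `c` the coefficient i_j.
  ^∣*-split : ∀ k a c → p ^ k ∣ a * c → p ∣ c ⊎ p ^ k ∣ a
  ^∣*-split zero    a c _ = inj₂ (1∣ a)
  ^∣*-split (suc k) a c d with euclidsLemma a c p-prime (∣-trans (m∣m*n (p ^ k)) d)
  ... | inj₂ p∣c = inj₁ p∣c
  ... | inj₁ (divides a′ ≡-refl)
      with ^∣*-split k a′ c (*-cancelˡ-∣ p {{prime⇒nonZero p-prime}}
             (subst (p * p ^ k ∣_) (rearrange a′ p c) d))
    where
    rearrange : ∀ a′ p c → a′ * p * c ≡ p * (a′ * c)
    rearrange = solve-∀
  ...   | inj₁ p∣c = inj₁ p∣c
  ...   | inj₂ d′ = inj₂ (subst (p * p ^ k ∣_) (*-comm p a′) (*-monoʳ-∣ p d′))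

-- Polynomials are represented by their coefficient sequences.

conv : (ℕ → ℕ) → (ℕ → ℕ) → ℕ → ℕ
conv a b zero    = a 0 * b 0
conv a b (suc k) = a 0 * b (suc k) + conv (a ∘ suc) b k

conv-+ : ∀ (a b c d : ℕ → ℕ) → (∀ i → a i ≡ b i + c i) →
         ∀ k → conv a d k ≡ conv b d k + conv c d k
conv-+ a b c d eq zero    = ≡.trans (cong (_* d 0) (eq 0)) (*-distribʳ-+ (d 0) (b 0) (c 0))
conv-+ a b c d eq (suc k) = begin
  a 0 * d (suc k) + conv (a ∘ suc) d k
    ≡⟨ cong₂ (λ u v → u * d (suc k) + v) (eq 0) (conv-+ _ _ _ d (eq ∘ suc) k) ⟩
  (b 0 + c 0) * d (suc k) + (conv (b ∘ suc) d k + conv (c ∘ suc) d k)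
    ≡⟨ rearrange (b 0) (c 0) (d (suc k)) _ _ ⟩
  conv b d (suc k) + conv c d (suc k) ∎
  where
  open ≡-Reasoning
  rearrange : ∀ x y z u v → (x + y) * z + (u + v) ≡ x * z + u + (y * z + v)
  rearrange = solve-∀

conv-cong : ∀ {a a′ b b′ : ℕ → ℕ} → (∀ i → a i ≡ a′ i) → (∀ i → b i ≡ b′ i) →
            ∀ k → conv a b k ≡ conv a′ b′ k
conv-cong eqa eqb zero    = cong₂ _*_ (eqa 0) (eqb 0)
conv-cong eqa eqb (suc k) =
  cong₂ _+_ (cong₂ _*_ (eqa 0) (eqb (suc k))) (conv-cong (eqa ∘ suc) eqb k)

conv-zero : ∀ (b : ℕ → ℕ) k → conv (λ _ → 0) b k ≡ 0
conv-zero b zero    = ≡-refl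
conv-zero b (suc k) = conv-zero b k

-- Products of polynomials modulo p

module ConvolutionModPrime {p} (p-prime : Prime p) where
  open PrimePowers p-prime

  -- Degree at most `d` modulo p.
  DivisibleAbove : ℕ → (ℕ → ℕ) → Set
  DivisibleAbove d a = ∀ i → d < i → p ∣ a i

  ∣-conv : ∀ a b k → (∀ i → p ∣ a i) → p ∣ conv a b k
  ∣-conv a b zero    h = ∣m⇒∣m*n (b 0) (h 0)
  ∣-conv a b (suc k) h = ∣m∣n⇒∣m+n (∣m⇒∣m*n (b (suc k)) (h 0)) (∣-conv (a ∘ suc) b k (h ∘ suc))

  -- Every other product `a i * b j` with i + j = d + e has i > d or j > e, so it vanishes modulo p.
  leading-term : ∀ d e a b → DivisibleAbove d a → DivisibleAbove e b →
                 p ∣ conv a b (d + e) → p ∣ a d * b e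
  leading-term zero zero    a b ha hb h = h
  leading-term zero (suc e) a b ha hb h =
    ∣m+n∣m⇒∣n (subst (p ∣_) (+-comm (a 0 * b (suc e)) _) h)
      (∣-conv (a ∘ suc) b e (λ i → ha (suc i) z<s))
  leading-term (suc d) e    a b ha hb h =
    leading-term d e (a ∘ suc) b (λ i d<i → ha (suc i) (s<s d<i)) hb
      (∣m+n∣m⇒∣n h (∣n⇒∣m*n (a 0) (hb (suc (d + e)) (s≤s (m≤n+m e d)))))

  lower : ∀ {d a} → DivisibleAbove (suc d) a → p ∣ a (suc d) → DivisibleAbove d a
  lower {d} h hd i d<i with m≤n⇒m<n∨m≡n d<i
  ... | inj₁ lt   = h i lt
  ... | inj₂ ≡-refl = hd

  -- As long as d + e > 0, p divides one of the two top coefficients, so one degree bound can be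
  -- lowered. A bound that is already 0 is never the one concerned, since its top coefficient is the
  -- constant term 1.
  conv≡1⇒factors≡1 : ∀ d e a b → a 0 ≡ 1 → b 0 ≡ 1 → DivisibleAbove d a → DivisibleAbove e b →
                     (∀ k → p ∣ conv a b (suc k)) → DivisibleAbove 0 a × DivisibleAbove 0 b
  conv≡1⇒factors≡1 zero zero a b a0 b0 ha hb h = ha , hb
  conv≡1⇒factors≡1 zero (suc e) a b a0 b0 ha hb h
    with euclidsLemma (a 0) (b (suc e)) p-prime (leading-term 0 (suc e) a b ha hb (h e))
  ... | inj₁ p∣a0 = ⊥-elim (∤1 (subst (p ∣_) a0 p∣a0))
  ... | inj₂ p∣b  = conv≡1⇒factors≡1 zero e a b a0 b0 ha (lower hb p∣b) h
  conv≡1⇒factors≡1 (suc d) e a b a0 b0 ha hb h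
    with euclidsLemma (a (suc d)) (b e) p-prime (leading-term (suc d) e a b ha hb (h (d + e)))
  ... | inj₁ p∣a = conv≡1⇒factors≡1 d e a b a0 b0 (lower ha p∣a) hb h
  conv≡1⇒factors≡1 (suc d) zero a b a0 b0 ha hb h    | inj₂ p∣b0 = ⊥-elim (∤1 (subst (p ∣_) b0 p∣b0))
  conv≡1⇒factors≡1 (suc d) (suc e) a b a0 b0 ha hb h | inj₂ p∣b  =
    conv≡1⇒factors≡1 (suc d) e a b a0 b0 ha (lower hb p∣b) h

-- Coefficients of the path and cycle polynomials

choose₂ choose₃ : ℕ → ℕ
choose₂ zero    = 0
choose₂ (suc n) = choose₂ n + n
choose₃ zero    = 0
choose₃ (suc n) = choose₃ n + choose₂ n

2*choose₂ : ∀ n → 2 * choose₂ n + n ≡ n * n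
2*choose₂ zero    = ≡-refl
2*choose₂ (suc n) = ≡.trans (step₁ (choose₂ n) n) (≡.trans (cong (_+ suc (2 * n)) (2*choose₂ n)) (step₂ n))
  where
  step₁ : ∀ c n → 2 * (c + n) + suc n ≡ 2 * c + n + suc (2 * n)
  step₁ = solve-∀
  step₂ : ∀ n → n * n + suc (2 * n) ≡ suc n * suc n
  step₂ = solve-∀

choose₂-+ : ∀ m n → choose₂ (m + n) ≡ choose₂ m + choose₂ n + m * n
choose₂-+ zero n    = sym (+-identityʳ (choose₂ n))
choose₂-+ (suc m) n = ≡.trans (cong (_+ (m + n)) (choose₂-+ m n)) (rearrange (choose₂ m) (choose₂ n) m n)
  where
  rearrange : ∀ x y m n → x + y + m * n + (m + n) ≡ x + m + y + (n + m * n)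
  rearrange = solve-∀

-- The independence polynomial of the path on `m` vertices, split by whether an end vertex is
-- chosen.
pathPoly : ℕ → ℕ → ℕ
pathPoly m             zero          = 1
pathPoly 0             (suc j)       = 0
pathPoly 1             (suc zero)    = 1
pathPoly 1             (suc (suc j)) = 0
pathPoly (suc (suc m)) (suc j)       = pathPoly (suc m) (suc j) + pathPoly m j

-- The independence polynomial of C_n and of D_n for n ≥ 3 (junk for smaller n).
cyclePoly : ℕ → ℕ → ℕ
cyclePoly n zero    = 1
cyclePoly n (suc j) = pathPoly (n ∸ 1) (suc j) + pathPoly (n ∸ 3) j

pathPoly-0 : ∀ m → pathPoly m 0 ≡ 1
pathPoly-0 zero          = ≡-refl
pathPoly-0 (suc zero)    = ≡-refl
pathPoly-0 (suc (suc m)) = ≡-refl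

pathPoly-degree : ∀ m j → m < j → pathPoly m j ≡ 0
pathPoly-degree 0             (suc j)       _         = ≡-refl
pathPoly-degree 1             (suc zero)    (s≤s ())
pathPoly-degree 1             (suc (suc j)) _         = ≡-refl
pathPoly-degree (suc (suc m)) (suc j)       (s≤s m<j) =
  cong₂ _+_ (pathPoly-degree (suc m) (suc j) (m<n⇒m<1+n m<j)) (pathPoly-degree m j (<-trans (n<1+n m) m<j))

pathPoly-1 : ∀ m → pathPoly m 1 ≡ m
pathPoly-1 zero          = ≡-refl
pathPoly-1 (suc zero)    = ≡-refl
pathPoly-1 (suc (suc m)) = ≡.trans (cong₂ _+_ (pathPoly-1 (suc m)) (pathPoly-0 m)) (+-comm (suc m) 1)

pathPoly-2 : ∀ m → pathPoly (suc m) 2 ≡ choose₂ m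
pathPoly-2 zero    = ≡-refl
pathPoly-2 (suc m) = cong₂ _+_ (pathPoly-2 m) (pathPoly-1 m)

pathPoly-3 : ∀ m → pathPoly (suc (suc m)) 3 ≡ choose₃ m
pathPoly-3 zero    = ≡-refl
pathPoly-3 (suc m) = cong₂ _+_ (pathPoly-3 m) (pathPoly-2 m)

-- Two mutually inductive consequences of pathPoly m j = C(m+1-j, j), free of subtraction.
path-absorb : ∀ m j → suc j * pathPoly (2 + m) (suc j) + j * pathPoly m j ≡ (2 + m) * pathPoly m j
path-ratio : ∀ m j → (2 + m) * pathPoly m j + 2 * j * pathPoly (suc m) j
                   ≡ (2 + m) * pathPoly (suc m) j + j * pathPoly m j

path-absorb zero zero          = ≡-refl
path-absorb zero (suc zero)    = ≡-refl
path-absorb zero (suc (suc j)) = cong₂ _+_ (*-zeroʳ (3 + j)) (*-zeroʳ (2 + j))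
-- The added `j * pathPoly m j` completes the left side of the induction hypothesis and comes back
-- out of `path-ratio`.
path-absorb (suc m) j = +-cancelʳ-≡ (j * pathPoly m j) _ _ (begin
  suc j * (p₂ + p₁) + j * p₁ + j * p₀      ≡⟨ step₁ j p₀ p₁ p₂ ⟩
  (suc j * p₂ + j * p₀) + (2 * j * p₁ + p₁) ≡⟨ cong (_+ (2 * j * p₁ + p₁)) (path-absorb m j) ⟩
  (2 + m) * p₀ + (2 * j * p₁ + p₁)          ≡⟨ +-assoc ((2 + m) * p₀) _ _ ⟨
  (2 + m) * p₀ + 2 * j * p₁ + p₁            ≡⟨ cong (_+ p₁) (path-ratio m j) ⟩
  (2 + m) * p₁ + j * p₀ + p₁                ≡⟨ step₂ m j p₀ p₁ ⟩
  (3 + m) * p₁ + j * p₀                     ∎)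
  where
  open ≡-Reasoning
  p₀ = pathPoly m j
  p₁ = pathPoly (suc m) j
  p₂ = pathPoly (2 + m) (suc j)
  step₁ : ∀ j p₀ p₁ p₂ → suc j * (p₂ + p₁) + j * p₁ + j * p₀
        ≡ (suc j * p₂ + j * p₀) + (2 * j * p₁ + p₁)
  step₁ = solve-∀
  step₂ : ∀ m j p₀ p₁ → (2 + m) * p₁ + j * p₀ + p₁ ≡ (3 + m) * p₁ + j * p₀
  step₂ = solve-∀

path-ratio m zero rewrite pathPoly-0 m | pathPoly-0 (suc m) = ≡-refl
path-ratio zero (suc zero)    = ≡-refl
path-ratio zero (suc (suc j)) = ≡.trans (*-zeroʳ (2 * (2 + j))) (sym (*-zeroʳ (2 + j)))
path-ratio (suc m) (suc j) = begin
  (3 + m) * p₁ + 2 * suc j * (p₁ + p₀)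
    ≡⟨ step₁ m j p₀ p₁ ⟩
  (3 + m) * p₁ + suc j * p₁ + p₀ + (suc j * (p₁ + p₀) + j * p₀)
    ≡⟨ cong (λ u → (3 + m) * p₁ + suc j * p₁ + p₀ + u) (path-absorb m j) ⟩
  (3 + m) * p₁ + suc j * p₁ + p₀ + (2 + m) * p₀
    ≡⟨ step₂ m j p₀ p₁ ⟩
  (3 + m) * (p₁ + p₀) + suc j * p₁ ∎
  where
  open ≡-Reasoning
  p₀ = pathPoly m j
  p₁ = pathPoly (suc m) (suc j)
  step₁ : ∀ m j p₀ p₁ → (3 + m) * p₁ + 2 * suc j * (p₁ + p₀)
        ≡ (3 + m) * p₁ + suc j * p₁ + p₀ + (suc j * (p₁ + p₀) + j * p₀)
  step₁ = solve-∀
  step₂ : ∀ m j p₀ p₁ → (3 + m) * p₁ + suc j * p₁ + p₀ + (2 + m) * p₀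
        ≡ (3 + m) * (p₁ + p₀) + suc j * p₁
  step₂ = solve-∀

-- Double counting of pairs of a vertex and an independent set of size j + 1 containing it: removing
-- a vertex of C_n and its two neighbours leaves a path on n - 3 vertices. The formal derivation
-- goes through `path-absorb`.
cycle-absorb : ∀ m j → suc j * cyclePoly (3 + m) (suc j) ≡ (3 + m) * pathPoly m j
cycle-absorb m j = ≡.trans (rearrange j _ (pathPoly m j))
  (≡.trans (cong (_+ pathPoly m j) (path-absorb m j)) (+-comm ((2 + m) * pathPoly m j) _))
  where
  rearrange : ∀ j q p → suc j * (q + p) ≡ suc j * q + j * p + p
  rearrange = solve-∀

module _ {p} (p-prime : Prime p) where
  open PrimePowers p-prime

  -- By `cycle-absorb`, p^k divides the product of index and coefficient. If p does not divide the
  -- coefficient, p^k divides the positive index, which is then at least n and beyond the degree, so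
  -- the coefficient is 0.
  ∣cyclePoly : ∀ k → 3 ≤ p ^ k → ∀ j → p ∣ cyclePoly (p ^ k) (suc j)
  ∣cyclePoly k 3≤n j with ^∣*-split k (suc j) (cyclePoly (p ^ k) (suc j)) n∣
    where
    m = p ^ k ∸ 3
    n≡ : 3 + m ≡ p ^ k
    n≡ = m+[n∸m]≡n 3≤n
    n∣ : p ^ k ∣ suc j * cyclePoly (p ^ k) (suc j)
    n∣ = subst (λ n → n ∣ suc j * cyclePoly n (suc j)) n≡
           (subst (3 + m ∣_) (sym (cycle-absorb m j)) (m∣m*n (pathPoly m j)))
  ... | inj₁ h = h
  ... | inj₂ n∣j = subst (p ∣_) (sym vanish) (p ∣0)
    where
    n≤ : p ^ k ≤ suc j
    n≤ = ∣⇒≤ n∣j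
    vanish : cyclePoly (p ^ k) (suc j) ≡ 0
    vanish = cong₂ _+_ (pathPoly-degree (p ^ k ∸ 1) (suc j) (lt 3≤n n≤))
                       (pathPoly-degree (p ^ k ∸ 3) j (lt₃ 3≤n n≤))
      where
      lt : ∀ {n} → 3 ≤ n → n ≤ suc j → n ∸ 1 < suc j
      lt (s≤s _) h = h
      lt₃ : ∀ {n} → 3 ≤ n → n ≤ suc j → n ∸ 3 < j
      lt₃ (s≤s (s≤s (s≤s {n = n} _))) (s≤s h) = ≤-trans (n≤1+n (suc n)) h

-- Values at -1/4

2^-injective : ∀ {i j} → 2 ^ i ≡ 2 ^ j → i ≡ j
2^-injective {i} {j} eq with <-cmp i j
... | tri< i<j _ _ = ⊥-elim (<-irrefl eq (^-monoʳ-< 2 ≤-refl i<j))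
... | tri≈ _ e _   = e
... | tri> _ _ j<i = ⊥-elim (<-irrefl (sym eq) (^-monoʳ-< 2 ≤-refl j<i))

-- 4 ^ s times the value at -1/4 of a polynomial of degree at most s.
eval : ℕ → (ℕ → ℕ) → ℤ
eval zero    a = pos (a 0)
eval (suc s) a = pos (4 ^ suc s * a 0) ℤ.- eval s (a ∘ suc)

eval-cong : ∀ s {a b : ℕ → ℕ} → (∀ i → a i ≡ b i) → eval s a ≡ eval s b
eval-cong zero    eq = cong pos (eq 0)
eval-cong (suc s) eq =
  cong₂ (λ x y → pos (4 ^ suc s * x) ℤ.- y) (eq 0) (eval-cong s (eq ∘ suc))

eval-+ : ∀ s (a b c : ℕ → ℕ) → (∀ i → a i ≡ b i + c i) → eval s a ≡ eval s b ℤ.+ eval s c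
eval-+ zero    a b c eq = cong pos (eq 0)
eval-+ (suc s) a b c eq = begin
  pos (q * a 0) ℤ.- eval s (a ∘ suc)
    ≡⟨ cong₂ (λ x y → pos x ℤ.- y) (≡.trans (cong (q *_) (eq 0)) (*-distribˡ-+ q (b 0) (c 0)))
         (eval-+ s _ _ _ (eq ∘ suc)) ⟩
  pos (q * b 0 + q * c 0) ℤ.- (eval s (b ∘ suc) ℤ.+ eval s (c ∘ suc))
    ≡⟨ rearrange (pos (q * b 0)) (pos (q * c 0)) (eval s (b ∘ suc)) (eval s (c ∘ suc)) ⟩
  eval (suc s) b ℤ.+ eval (suc s) c ∎
  where
  open ≡-Reasoning
  q = 4 ^ suc s
  rearrange : ∀ x y u v → (x ℤ.+ y) ℤ.- (u ℤ.+ v) ≡ (x ℤ.- u) ℤ.+ (y ℤ.- v)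
  rearrange = ℤRing.solve-∀

-- Here `a` is `b + x c`. The factor x = -1/4 uses up one power of 4, hence the smaller bound for
-- `c`.
eval-shift : ∀ s (a b c : ℕ → ℕ) → a 0 ≡ b 0 → (∀ i → a (suc i) ≡ b (suc i) + c i) →
             eval (suc s) a ≡ eval (suc s) b ℤ.- eval s c
eval-shift s a b c eq₀ eq = begin
  pos (4 ^ suc s * a 0) ℤ.- eval s (a ∘ suc)
    ≡⟨ cong₂ (λ x y → pos (4 ^ suc s * x) ℤ.- y) eq₀ (eval-+ s _ _ _ eq) ⟩
  pos (4 ^ suc s * b 0) ℤ.- (eval s (b ∘ suc) ℤ.+ eval s c)
    ≡⟨ rearrange (pos (4 ^ suc s * b 0)) (eval s (b ∘ suc)) (eval s c) ⟩
  eval (suc s) b ℤ.- eval s c ∎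
  where
  open ≡-Reasoning
  rearrange : ∀ x u v → x ℤ.- (u ℤ.+ v) ≡ (x ℤ.- u) ℤ.- v
  rearrange = ℤRing.solve-∀

eval-suc : ∀ s (a : ℕ → ℕ) → a (suc s) ≡ 0 → eval (suc s) a ≡ pos 4 ℤ.* eval s a
eval-suc zero a h = begin
  pos (4 * a 0) ℤ.- pos (a 1) ≡⟨ cong (λ x → pos (4 * a 0) ℤ.- pos x) h ⟩
  pos (4 * a 0) ℤ.- pos 0   ≡⟨ ℤ.+-identityʳ _ ⟩
  pos (4 * a 0)           ≡⟨ ℤ.pos-* 4 (a 0) ⟩
  pos 4 ℤ.* pos (a 0)         ∎
  where open ≡-Reasoning
eval-suc (suc s) a h = begin
  pos (4 * q * a 0) ℤ.- eval (suc s) (a ∘ suc)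
    ≡⟨ cong₂ (λ x y → pos x ℤ.- y) (*-assoc 4 q (a 0)) (eval-suc s (a ∘ suc) h) ⟩
  pos (4 * (q * a 0)) ℤ.- pos 4 ℤ.* eval s (a ∘ suc)
    ≡⟨ cong (λ x → x ℤ.- pos 4 ℤ.* eval s (a ∘ suc)) (ℤ.pos-* 4 (q * a 0)) ⟩
  pos 4 ℤ.* pos (q * a 0) ℤ.- pos 4 ℤ.* eval s (a ∘ suc)
    ≡⟨ factor (pos (q * a 0)) _ ⟩
  pos 4 ℤ.* eval (suc s) a ∎
  where
  open ≡-Reasoning
  q = 4 ^ suc s
  factor : ∀ x y → pos 4 ℤ.* x ℤ.- pos 4 ℤ.* y ≡ pos 4 ℤ.* (x ℤ.- y)
  factor = ℤRing.solve-∀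

eval-pathPoly-rec : ∀ m → eval (2 + m) (pathPoly (2 + m))
                        ≡ pos 4 ℤ.* eval (suc m) (pathPoly (suc m)) ℤ.- pos 4 ℤ.* eval m (pathPoly m)
eval-pathPoly-rec m = begin
  eval (2 + m) (pathPoly (2 + m))
    ≡⟨ eval-shift (suc m) (pathPoly (2 + m)) (pathPoly (suc m)) (pathPoly m) (sym (pathPoly-0 (suc m))) (λ _ → ≡-refl) ⟩
  eval (2 + m) (pathPoly (suc m)) ℤ.- eval (suc m) (pathPoly m)
    ≡⟨ cong₂ ℤ._-_ (eval-suc (suc m) (pathPoly (suc m)) (pathPoly-degree (suc m) (2 + m) ≤-refl))
                   (eval-suc m (pathPoly m) (pathPoly-degree m (suc m) ≤-refl)) ⟩
  pos 4 ℤ.* eval (suc m) (pathPoly (suc m)) ℤ.- pos 4 ℤ.* eval m (pathPoly m) ∎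
  where open ≡-Reasoning

-- The recurrence of `eval-pathPoly-rec` has characteristic polynomial (t - 2)^2, so its solution is
-- a linear function of m times `2 ^ m`, namely 1 + m/2; the factor 2 clears the denominator.
eval-pathPoly : ∀ m → pos 2 ℤ.* eval m (pathPoly m) ≡ (pos 2 ℤ.+ pos m) ℤ.* pos (2 ^ m)
eval-pathPoly zero       = ≡-refl
eval-pathPoly (suc zero) = ≡-refl
eval-pathPoly (suc (suc m)) = begin
  pos 2 ℤ.* eval (2 + m) (pathPoly (2 + m))
    ≡⟨ cong (pos 2 ℤ.*_) (eval-pathPoly-rec m) ⟩
  pos 2 ℤ.* (pos 4 ℤ.* x ℤ.- pos 4 ℤ.* y)
    ≡⟨ step₁ x y ⟩
  pos 4 ℤ.* (pos 2 ℤ.* x) ℤ.- pos 4 ℤ.* (pos 2 ℤ.* y)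
    ≡⟨ cong₂ (λ u v → pos 4 ℤ.* u ℤ.- pos 4 ℤ.* v) (eval-pathPoly (suc m)) (eval-pathPoly m) ⟩
  pos 4 ℤ.* ((pos 2 ℤ.+ pos (suc m)) ℤ.* pos (2 * q)) ℤ.- pos 4 ℤ.* ((pos 2 ℤ.+ pos m) ℤ.* pos q)
    ≡⟨ cong (λ u → pos 4 ℤ.* ((pos 2 ℤ.+ pos (suc m)) ℤ.* u) ℤ.- pos 4 ℤ.* ((pos 2 ℤ.+ pos m) ℤ.* pos q)) (ℤ.pos-* 2 q) ⟩
  pos 4 ℤ.* ((pos 2 ℤ.+ (pos 1 ℤ.+ pos m)) ℤ.* (pos 2 ℤ.* pos q)) ℤ.- pos 4 ℤ.* ((pos 2 ℤ.+ pos m) ℤ.* pos q)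
    ≡⟨ step₂ (pos m) (pos q) ⟩
  (pos 2 ℤ.+ (pos 2 ℤ.+ pos m)) ℤ.* (pos 2 ℤ.* (pos 2 ℤ.* pos q))
    ≡⟨ cong ((pos 2 ℤ.+ (pos 2 ℤ.+ pos m)) ℤ.*_)
         (≡.trans (cong (pos 2 ℤ.*_) (sym (ℤ.pos-* 2 q))) (sym (ℤ.pos-* 2 (2 * q)))) ⟩
  (pos 2 ℤ.+ pos (2 + m)) ℤ.* pos (2 ^ (2 + m)) ∎
  where
  open ≡-Reasoning
  q = 2 ^ m
  x = eval (suc m) (pathPoly (suc m))
  y = eval m (pathPoly m)
  step₁ : ∀ x y → pos 2 ℤ.* (pos 4 ℤ.* x ℤ.- pos 4 ℤ.* y) ≡ pos 4 ℤ.* (pos 2 ℤ.* x) ℤ.- pos 4 ℤ.* (pos 2 ℤ.* y)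
  step₁ = ℤRing.solve-∀
  step₂ : ∀ m q → pos 4 ℤ.* ((pos 2 ℤ.+ (pos 1 ℤ.+ m)) ℤ.* (pos 2 ℤ.* q)) ℤ.- pos 4 ℤ.* ((pos 2 ℤ.+ m) ℤ.* q)
        ≡ (pos 2 ℤ.+ (pos 2 ℤ.+ m)) ℤ.* (pos 2 ℤ.* (pos 2 ℤ.* q))
  step₂ = ℤRing.solve-∀

-- The two paths in `cyclePoly` contribute the linear factors `4 + m` and `2 + m` with equal weight.
-- Their difference is 2 for every m, which removes the dependence on the length except for the
-- power of 2.
eval-cyclePoly : ∀ m → eval (3 + m) (cyclePoly (3 + m)) ≡ pos (2 ^ suc (3 + m))
eval-cyclePoly m = ℤ.*-cancelˡ-≡ (pos 2) _ _ (begin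
  pos 2 ℤ.* eval (3 + m) (cyclePoly (3 + m))
    ≡⟨ cong (pos 2 ℤ.*_) (begin
         eval (3 + m) (cyclePoly (3 + m))
           ≡⟨ eval-shift (2 + m) (cyclePoly (3 + m)) (pathPoly (2 + m)) (pathPoly m) ≡-refl (λ _ → ≡-refl) ⟩
         eval (3 + m) (pathPoly (2 + m)) ℤ.- eval (2 + m) (pathPoly m)
           ≡⟨ cong₂ ℤ._-_ (eval-suc (2 + m) (pathPoly (2 + m)) (pathPoly-degree (2 + m) (3 + m) ≤-refl))
                (≡.trans (eval-suc (suc m) (pathPoly m) (pathPoly-degree m (2 + m) (n≤1+n (suc m))))
                       (cong (pos 4 ℤ.*_) (eval-suc m (pathPoly m) (pathPoly-degree m (suc m) ≤-refl)))) ⟩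
         pos 4 ℤ.* x ℤ.- pos 4 ℤ.* (pos 4 ℤ.* y) ∎) ⟩
  pos 2 ℤ.* (pos 4 ℤ.* x ℤ.- pos 4 ℤ.* (pos 4 ℤ.* y))
    ≡⟨ step₁ x y ⟩
  pos 4 ℤ.* (pos 2 ℤ.* x) ℤ.- pos 16 ℤ.* (pos 2 ℤ.* y)
    ≡⟨ cong₂ (λ u v → pos 4 ℤ.* u ℤ.- pos 16 ℤ.* v) (eval-pathPoly (2 + m)) (eval-pathPoly m) ⟩
  pos 4 ℤ.* ((pos 2 ℤ.+ pos (2 + m)) ℤ.* pos (2 ^ (2 + m))) ℤ.- pos 16 ℤ.* ((pos 2 ℤ.+ pos m) ℤ.* pos q)
    ≡⟨ cong (λ u → pos 4 ℤ.* ((pos 2 ℤ.+ pos (2 + m)) ℤ.* u) ℤ.- pos 16 ℤ.* ((pos 2 ℤ.+ pos m) ℤ.* pos q))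
         (pos-2^ 2) ⟩
  pos 4 ℤ.* ((pos 2 ℤ.+ (pos 2 ℤ.+ pos m)) ℤ.* (pos 4 ℤ.* pos q)) ℤ.- pos 16 ℤ.* ((pos 2 ℤ.+ pos m) ℤ.* pos q)
    ≡⟨ step₂ (pos m) (pos q) ⟩
  pos 2 ℤ.* (pos 16 ℤ.* pos q)
    ≡⟨ cong (pos 2 ℤ.*_) (sym (pos-2^ 4)) ⟩
  pos 2 ℤ.* pos (2 ^ (4 + m)) ∎)
  where
  open ≡-Reasoning
  q = 2 ^ m
  x = eval (2 + m) (pathPoly (2 + m))
  y = eval m (pathPoly m)
  pos-2^ : ∀ i → pos (2 ^ (i + m)) ≡ pos (2 ^ i) ℤ.* pos q
  pos-2^ i = ≡.trans (cong pos (^-distribˡ-+-* 2 i m)) (ℤ.pos-* (2 ^ i) q)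
  step₁ : ∀ x y → pos 2 ℤ.* (pos 4 ℤ.* x ℤ.- pos 4 ℤ.* (pos 4 ℤ.* y)) ≡ pos 4 ℤ.* (pos 2 ℤ.* x) ℤ.- pos 16 ℤ.* (pos 2 ℤ.* y)
  step₁ = ℤRing.solve-∀
  step₂ : ∀ m q → pos 4 ℤ.* ((pos 2 ℤ.+ (pos 2 ℤ.+ m)) ℤ.* (pos 4 ℤ.* q)) ℤ.- pos 16 ℤ.* ((pos 2 ℤ.+ m) ℤ.* q)
        ≡ pos 2 ℤ.* (pos 16 ℤ.* q)
  step₂ = ℤRing.solve-∀

-- Independence polynomials of vertex lists

bit : Bool → ℕ
bit b = if b then 1 else 0

bit-split : ∀ a b → bit (a ∧ b) + bit (a ∧ not b) ≡ bit a
bit-split true true   = ≡-refl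
bit-split true false  = ≡-refl
bit-split false true  = ≡-refl
bit-split false false = ≡-refl

bit-∧ : ∀ a b → bit (a ∧ b) ≡ bit a * bit b
bit-∧ true b  = sym (+-identityʳ (bit b))
bit-∧ false b = ≡-refl

choose₂-bit : ∀ b n → choose₂ (bit b + n) ≡ choose₂ n + bit b * n
choose₂-bit true  n = cong (λ m → choose₂ n + m) (sym (+-identityʳ n))
choose₂-bit false n = sym (+-identityʳ (choose₂ n))

module _ {V : Set} where

  sumOver : (V → ℕ) → List V → ℕ
  sumOver h []      = 0
  sumOver h (v ∷ L) = h v + sumOver h L

  sumOver-cong : ∀ {h h′ : V → ℕ} L → (∀ {v} → v ∈ L → h v ≡ h′ v) → sumOver h L ≡ sumOver h′ L
  sumOver-cong []      eq = ≡-refl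
  sumOver-cong (v ∷ L) eq = cong₂ _+_ (eq (here ≡-refl)) (sumOver-cong L (eq ∘ there))

  sumOver-+ : ∀ (h h′ : V → ℕ) L → sumOver (λ v → h v + h′ v) L ≡ sumOver h L + sumOver h′ L
  sumOver-+ h h′ []      = ≡-refl
  sumOver-+ h h′ (v ∷ L) =
    ≡.trans (cong (λ s → h v + h′ v + s) (sumOver-+ h h′ L)) (interchange (h v) (h′ v) _ _)
    where
    interchange : ∀ a b c d → a + b + (c + d) ≡ a + c + (b + d)
    interchange = solve-∀

  sumOver-++ : ∀ h (A B : List V) → sumOver h (A ++ B) ≡ sumOver h A + sumOver h B
  sumOver-++ h []      B = ≡-refl
  sumOver-++ h (v ∷ A) B = ≡.trans (cong (λ s → h v + s) (sumOver-++ h A B)) (sym (+-assoc (h v) _ _))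

  sumOver-↭ : ∀ h {A B : List V} → A ↭ B → sumOver h A ≡ sumOver h B
  sumOver-↭ h refl       = ≡-refl
  sumOver-↭ h (prep x p) = cong (λ s → h x + s) (sumOver-↭ h p)
  sumOver-↭ h (swap {xs} {ys} x y p) =
    ≡.trans (cong (λ s → h x + (h y + s)) (sumOver-↭ h p)) (interchange (h x) (h y) (sumOver h ys))
    where
    interchange : ∀ a b c → a + (b + c) ≡ b + (a + c)
    interchange = solve-∀
  sumOver-↭ h (trans p q) = ≡.trans (sumOver-↭ h p) (sumOver-↭ h q)

  sumOver-∈ : ∀ h {L : List V} {v} → v ∈ L → h v ≤ sumOver h L
  sumOver-∈ h (here ≡-refl)  = m≤m+n _ _
  sumOver-∈ h {x ∷ L} (there p) = ≤-trans (sumOver-∈ h p) (m≤n+m _ (h x))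

  count : (V → Bool) → List V → ℕ
  count f = sumOver (bit ∘ f)

  count-all : ∀ L → count (λ _ → true) L ≡ length L
  count-all []      = ≡-refl
  count-all (v ∷ L) = cong suc (count-all L)

  count-split : ∀ (f g : V → Bool) L →
                count (λ u → f u ∧ g u) L + count (λ u → f u ∧ not (g u)) L ≡ count f L
  count-split f g L =
    ≡.trans (sym (sumOver-+ _ _ L)) (sumOver-cong L (λ {v} _ → bit-split (f v) (g v)))

  count≡0⇒false : ∀ (f : V → Bool) {L} → count f L ≡ 0 → ∀ {v} → v ∈ L → f v ≡ false
  count≡0⇒false f {L} h {v} v∈L with f v | sumOver-∈ (bit ∘ f) v∈L
  ... | false | _ = ≡-refl
  ... | true  | q = case subst (1 ≤_) h q of λ ()

  false⇒count≡0 : ∀ (f : V → Bool) L → (∀ {v} → v ∈ L → f v ≡ false) → count f L ≡ 0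
  false⇒count≡0 f []      h = ≡-refl
  false⇒count≡0 f (v ∷ L) h = cong₂ _+_ (cong bit (h (here ≡-refl))) (false⇒count≡0 f L (h ∘ there))

  extract : ∀ {x : V} {L} → x ∈ L → ∃ λ L′ → L ↭ x ∷ L′
  extract {L = _ ∷ L} (here ≡-refl) = L , refl
  extract {x} {y ∷ L} (there p) with extract p
  ... | L′ , q = y ∷ L′ , trans (prep y q) (swap y x refl)

  count⇒extract : ∀ (f : V → Bool) L → 1 ≤ count f L → ∃₂ λ x L′ → L ↭ x ∷ L′ × f x ≡ true
  count⇒extract f (v ∷ L) h with f v in eq
  ... | true  = v , L , refl , eq
  ... | false with count⇒extract f L h
  ...   | x , L′ , p , fx = x , v ∷ L′ , trans (prep v p) (swap v x refl) , fx

sumOver-mono : ∀ {V : Set} (h h′ : V → ℕ) L → (∀ {v} → v ∈ L → h v ≤ h′ v) → sumOver h L ≤ sumOver h′ L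
sumOver-mono h h′ []      le = z≤n
sumOver-mono h h′ (v ∷ L) le = +-mono-≤ (le (here ≡-refl)) (sumOver-mono h h′ L (le ∘ there))

+-tight : ∀ {a b c d} → a ≤ c → b ≤ d → a + b ≡ c + d → a ≡ c × b ≡ d
+-tight {a} {b} {c} {d} a≤c b≤d eq with m≤n⇒m<n∨m≡n a≤c
... | inj₁ a<c    = ⊥-elim (<-irrefl eq (+-mono-<-≤ a<c b≤d))
... | inj₂ ≡-refl = ≡-refl , +-cancelˡ-≡ a b d eq

-- This carries equalities of totals over the whole graph to the single components, and in `listing`
-- from the degree sum to the single vertices.
sumOver-tight : ∀ {V : Set} (h h′ : V → ℕ) L → (∀ {v} → v ∈ L → h v ≤ h′ v) →
                sumOver h L ≡ sumOver h′ L → ∀ {v} → v ∈ L → h v ≡ h′ v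
sumOver-tight h h′ (x ∷ L) le eq v∈
  with +-tight (le (here ≡-refl)) (sumOver-mono h h′ L (le ∘ there)) eq
sumOver-tight h h′ (x ∷ L) le eq (here ≡-refl) | hx , _ = hx
sumOver-tight h h′ (x ∷ L) le eq (there v∈L)   | _ , hL = sumOver-tight h h′ L (le ∘ there) hL v∈L

sumOver-const : ∀ {V : Set} c (L : List V) → sumOver (λ _ → c) L ≡ length L * c
sumOver-const c []      = ≡-refl
sumOver-const c (v ∷ L) = cong (c +_) (sumOver-const c L)

module Independence {V : Set} (adj : V → V → Bool)
         (adj-sym : ∀ u v → adj u v ≡ adj v u) (adj-irr : ∀ v → adj v v ≡ false) where

  every : V → Bool
  every _ = true

  infixl 6 _∖N_
  _∖N_ : (V → Bool) → V → V → Bool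
  (f ∖N v) u = f u ∧ not (adj v u)

  infixl 6 _∩N_
  _∩N_ : (V → Bool) → V → V → Bool
  (f ∩N v) u = f u ∧ adj v u

  -- The j-th coefficient of the independence polynomial of the subgraph induced by the members
  -- of L that satisfy f.
  indPoly : (V → Bool) → List V → ℕ → ℕ
  indPoly f L       zero    = 1
  indPoly f []      (suc j) = 0
  indPoly f (v ∷ L) (suc j) = indPoly f L (suc j) + (if f v then indPoly (f ∖N v) L j else 0)

  indPoly-cong : ∀ {f g} L → (∀ {v} → v ∈ L → f v ≡ g v) → ∀ j → indPoly f L j ≡ indPoly g L j
  indPoly-cong L       eq zero    = ≡-refl
  indPoly-cong []      eq (suc j) = ≡-refl
  indPoly-cong {f} {g} (v ∷ L) eq (suc j) rewrite eq (here ≡-refl) =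
    cong₂ (λ a b → a + (if g v then b else 0)) (indPoly-cong L (eq ∘ there) (suc j))
      (indPoly-cong L (λ {u} u∈L → cong (_∧ not (adj v u)) (eq (there u∈L))) j)

  ∖N-comm : ∀ f x y u → (f ∖N x ∖N y) u ≡ (f ∖N y ∖N x) u
  ∖N-comm f x y u = ≡.trans (∧-assoc (f u) _ _)
    (≡.trans (cong (f u ∧_) (∧-comm (not (adj x u)) _)) (sym (∧-assoc (f u) _ _)))

  -- Sorting the sets by which of `x` and `y` they contain gives the same four terms in either
  -- order. The term for both is absent if they are adjacent.
  indPoly-swap : ∀ f x y L j → indPoly f (x ∷ y ∷ L) j ≡ indPoly f (y ∷ x ∷ L) j
  indPoly-swap f x y L zero = ≡-refl
  indPoly-swap f x y L (suc zero) = interchange (indPoly f L 1) (if f y then 1 else 0) (if f x then 1 else 0)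
    where
    interchange : ∀ a b c → a + b + c ≡ a + c + b
    interchange = solve-∀
  indPoly-swap f x y L (suc (suc j)) with f x | f y
  ... | false | false = ≡-refl
  ... | true  | false = tidy (indPoly f L (2 + j)) (indPoly (f ∖N x) L (suc j))
    where
    tidy : ∀ a b → a + 0 + (b + 0) ≡ a + b + 0
    tidy = solve-∀
  ... | false | true  = tidy (indPoly f L (2 + j)) (indPoly (f ∖N y) L (suc j))
    where
    tidy : ∀ a b → a + b + 0 ≡ a + 0 + (b + 0)
    tidy = solve-∀
  ... | true  | true rewrite adj-sym y x with adj x y
  ...   | true  = interchange (indPoly f L (2 + j)) (indPoly (f ∖N y) L (suc j)) (indPoly (f ∖N x) L (suc j)) 0
    where
    interchange : ∀ a b c d → a + b + (c + d) ≡ a + c + (b + d)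
    interchange = solve-∀
  ...   | false = ≡.trans
      (cong (λ d → indPoly f L (2 + j) + indPoly (f ∖N y) L (suc j) + (indPoly (f ∖N x) L (suc j) + d))
            (indPoly-cong L (λ {u} _ → ∖N-comm f x y u) j))
      (interchange (indPoly f L (2 + j)) (indPoly (f ∖N y) L (suc j)) (indPoly (f ∖N x) L (suc j))
                   (indPoly (f ∖N y ∖N x) L j))
    where
    interchange : ∀ a b c d → a + b + (c + d) ≡ a + c + (b + d)
    interchange = solve-∀

  indPoly-prep : ∀ {L L′} x → (∀ f j → indPoly f L j ≡ indPoly f L′ j) →
                 ∀ f j → indPoly f (x ∷ L) j ≡ indPoly f (x ∷ L′) j
  indPoly-prep x eq f zero    = ≡-refl
  indPoly-prep x eq f (suc j) = cong₂ (λ a b → a + (if f x then b else 0)) (eq f (suc j)) (eq (f ∖N x) j)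

  indPoly-↭ : ∀ {L L′} → L ↭ L′ → ∀ f j → indPoly f L j ≡ indPoly f L′ j
  indPoly-↭ refl        f j = ≡-refl
  indPoly-↭ (trans p q) f j = ≡.trans (indPoly-↭ p f j) (indPoly-↭ q f j)
  indPoly-↭ (prep x p)  f j = indPoly-prep x (indPoly-↭ p) f j
  indPoly-↭ (swap {xs} {ys} x y p) f j =
    ≡.trans (indPoly-prep x (indPoly-prep y (indPoly-↭ p)) f j) (indPoly-swap f x y ys j)

  indPoly-0 : ∀ f L → indPoly f L 0 ≡ 1
  indPoly-0 f []      = ≡-refl
  indPoly-0 f (v ∷ L) = ≡-refl

  indPoly-degree : ∀ f L j → length L < j → indPoly f L j ≡ 0
  indPoly-degree f []      (suc j) _ = ≡-refl
  indPoly-degree f (v ∷ L) (suc j) (s≤s l<j)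
    rewrite indPoly-degree f L (suc j) (m<n⇒m<1+n l<j) | indPoly-degree (f ∖N v) L j l<j with f v
  ... | true  = ≡-refl
  ... | false = ≡-refl

  degreeIn : List V → V → ℕ
  degreeIn L v = count (adj v) L

  edges : (V → Bool) → List V → ℕ
  edges f []      = 0
  edges f (v ∷ L) = edges f L + bit (f v) * count (f ∩N v) L

  triangles : (V → Bool) → List V → ℕ
  triangles f []      = 0
  triangles f (v ∷ L) = triangles f L + bit (f v) * edges (f ∩N v) L

  indPoly-1 : ∀ f L → indPoly f L 1 ≡ count f L
  indPoly-1 f []      = ≡-refl
  indPoly-1 f (v ∷ L) = ≡.trans (cong (_+ _) (indPoly-1 f L)) (+-comm (count f L) _)

  indPoly-2 : ∀ f L → indPoly f L 2 + edges f L ≡ choose₂ (count f L)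
  indPoly-2 f []      = ≡-refl
  indPoly-2 f (v ∷ L) with f v
  ... | false = ≡.trans (tidy (indPoly f L 2) (edges f L)) (indPoly-2 f L)
    where
    tidy : ∀ a b → a + 0 + (b + 0) ≡ a + b
    tidy = solve-∀
  ... | true  = begin
    indPoly f L 2 + indPoly (f ∖N v) L 1 + (edges f L + (count (f ∩N v) L + 0))
      ≡⟨ cong (λ a → indPoly f L 2 + a + (edges f L + (count (f ∩N v) L + 0))) (indPoly-1 (f ∖N v) L) ⟩
    indPoly f L 2 + count (f ∖N v) L + (edges f L + (count (f ∩N v) L + 0))
      ≡⟨ tidy (indPoly f L 2) _ _ _ ⟩
    indPoly f L 2 + edges f L + (count (f ∩N v) L + count (f ∖N v) L)
      ≡⟨ cong₂ _+_ (indPoly-2 f L) (count-split f (adj v) L) ⟩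
    choose₂ (count f L) + count f L ∎
    where
    open ≡-Reasoning
    tidy : ∀ a b c d → a + b + (c + (d + 0)) ≡ a + c + (d + b)
    tidy = solve-∀

  edges≤choose₂ : ∀ f L → edges f L ≤ choose₂ (count f L)
  edges≤choose₂ f L = subst (edges f L ≤_) (indPoly-2 f L) (m≤n+m _ _)

  -- An edge with both ends in `g` is counted twice by the degree sum, one with a single end in `g`
  -- once, and one with no end in `g` is found in `edges (not ∘ g) L`.
  edges-split : ∀ g L → edges (not ∘ g) L + sumOver (λ u → bit (g u) * degreeIn L u) L
                      ≡ edges every L + edges g L
  edges-split g []      = ≡-refl
  edges-split g (v ∷ L) rewrite adj-irr v = begin
    (edges (not ∘ g) L + bit (not (g v)) * count ((not ∘ g) ∩N v) L)
      + (bit (g v) * degreeIn L v + sumOver (λ u → bit (g u) * (bit (adj u v) + degreeIn L u)) L)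
        ≡⟨ cong₂ (λ a b → edges (not ∘ g) L + bit (not (g v)) * a + (bit (g v) * degreeIn L v + b))
             (sumOver-cong L (λ {u} _ → cong bit (∧-comm (not (g u)) (adj v u)))) σ≡ ⟩
    (edges (not ∘ g) L + bit (not (g v)) * out)
      + (bit (g v) * degreeIn L v + (inn + sumOver (λ u → bit (g u) * degreeIn L u) L))
        ≡⟨ cong (λ a → (edges (not ∘ g) L + bit (not (g v)) * out)
             + (bit (g v) * a + (inn + sumOver (λ u → bit (g u) * degreeIn L u) L))) (sym deg≡) ⟩
    (edges (not ∘ g) L + bit (not (g v)) * out)
      + (bit (g v) * (inn + out) + (inn + sumOver (λ u → bit (g u) * degreeIn L u) L))
        ≡⟨ byCases (g v) ⟩
    (edges (not ∘ g) L + sumOver (λ u → bit (g u) * degreeIn L u) L) + ((inn + out) + bit (g v) * inn)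
        ≡⟨ cong₂ (λ a b → a + (b + bit (g v) * inn)) (edges-split g L) deg≡ ⟩
    (edges every L + edges g L) + (degreeIn L v + bit (g v) * inn)
        ≡⟨ cong (λ a → (edges every L + edges g L) + (degreeIn L v + bit (g v) * a))
             (sumOver-cong L (λ {u} _ → cong bit (∧-comm (adj v u) (g u)))) ⟩
    (edges every L + edges g L) + (degreeIn L v + bit (g v) * count (g ∩N v) L)
        ≡⟨ tidy (edges every L) (edges g L) (degreeIn L v) _ ⟩
    (edges every L + (degreeIn L v + 0)) + (edges g L + bit (g v) * count (g ∩N v) L) ∎
    where
    open ≡-Reasoning
    inn = count (λ u → adj v u ∧ g u) L
    out = count (λ u → adj v u ∧ not (g u)) L
    deg≡ : inn + out ≡ degreeIn L v
    deg≡ = count-split (adj v) g L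
    σ≡ : sumOver (λ u → bit (g u) * (bit (adj u v) + degreeIn L u)) L
       ≡ inn + sumOver (λ u → bit (g u) * degreeIn L u) L
    σ≡ = ≡.trans (sumOver-cong L (λ {u} _ → ≡.trans (*-distribˡ-+ (bit (g u)) _ _)
             (cong (_+ bit (g u) * degreeIn L u)
               (≡.trans (sym (bit-∧ (g u) (adj u v)))
                 (≡.trans (cong (λ b → bit (g u ∧ b)) (adj-sym u v)) (cong bit (∧-comm (g u) (adj v u))))))))
           (sumOver-+ _ _ L)
    byCases : ∀ b → (edges (not ∘ g) L + bit (not b) * out)
                      + (bit b * (inn + out) + (inn + sumOver (λ u → bit (g u) * degreeIn L u) L))
                  ≡ (edges (not ∘ g) L + sumOver (λ u → bit (g u) * degreeIn L u) L)
                      + ((inn + out) + bit b * inn)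
    byCases true  = lem (edges (not ∘ g) L) inn out _
      where
      lem : ∀ e i o s → (e + 0) + ((i + o + 0) + (i + s)) ≡ e + s + ((i + o) + (i + 0))
      lem = solve-∀
    byCases false = lem (edges (not ∘ g) L) inn out _
      where
      lem : ∀ e i o s → (e + (o + 0)) + (i + s) ≡ e + s + ((i + o) + 0)
      lem = solve-∀
    tidy : ∀ a b c d → (a + b) + (c + d) ≡ (a + (c + 0)) + (b + d)
    tidy = solve-∀

  sum-degrees : ∀ L → sumOver (degreeIn L) L ≡ 2 * edges every L
  sum-degrees []      = ≡-refl
  sum-degrees (v ∷ L) rewrite adj-irr v = begin
    degreeIn L v + sumOver (λ u → bit (adj u v) + degreeIn L u) L
      ≡⟨ cong (λ s → degreeIn L v + s) (sumOver-+ _ _ L) ⟩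
    degreeIn L v + (count (λ u → adj u v) L + sumOver (degreeIn L) L)
      ≡⟨ cong₂ (λ a b → degreeIn L v + (a + b))
           (sumOver-cong L (λ {u} _ → cong bit (adj-sym u v))) (sum-degrees L) ⟩
    degreeIn L v + (degreeIn L v + 2 * edges every L)
      ≡⟨ tidy (degreeIn L v) (edges every L) ⟩
    2 * (edges every L + (degreeIn L v + 0)) ∎
    where
    open ≡-Reasoning
    tidy : ∀ d e → d + (d + 2 * e) ≡ 2 * (e + (d + 0))
    tidy = solve-∀

  -- Inclusion and exclusion over the edges inside a triple: i_3 = C(n,3) - E(n - 2) + (sum of
  -- C(d,2)) - T. An edge lies in n - 2 triples, two edges inside a triple share a vertex, and three
  -- edges form a triangle.
  indPoly-3 : ∀ L → indPoly every L 3 + (triangles every L + edges every L * length L)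
                  ≡ choose₃ (length L) + (sumOver (choose₂ ∘ degreeIn L) L + 2 * edges every L)
  indPoly-3 []      = ≡-refl
  -- `EK` counts the edges among the non-neighbours of `v`. Adding it lets `indPoly-2` evaluate
  -- `Q₂`, and `edges-split` for the neighbourhood of `v` produces it again.
  indPoly-3 (v ∷ L) rewrite adj-irr v = +-cancelʳ-≡ EK _ _ (begin
    Q₃ + Q₂ + (T + (EN + 0) + (E + (d + 0)) * suc l) + EK
      ≡⟨ step₁ Q₃ Q₂ T EN E d l EK ⟩
    (Q₃ + (T + E * l)) + (Q₂ + EK) + (E + EN) + (d * l + d)
      ≡⟨ cong₂ (λ a b → a + b + (E + EN) + (d * l + d)) (indPoly-3 L) (indPoly-2 (every ∖N v) L) ⟩
    (choose₃ l + (S + 2 * E)) + choose₂ k + (E + EN) + (d * l + d)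
      ≡⟨ cong₂ (λ a b → (choose₃ l + (S + 2 * E)) + choose₂ k + a + (d * b + d))
           (sym (edges-split (adj v) L)) l≡ ⟩
    (choose₃ l + (S + 2 * E)) + choose₂ k + (EK + σ) + (d * (d + k) + d)
      ≡⟨ step₂ (choose₃ l) S E (choose₂ k) EK σ d k ⟩
    (choose₃ l + (S + 2 * E)) + choose₂ k + (EK + σ) + (d * d + (d * k + d))
      ≡⟨ cong (λ a → (choose₃ l + (S + 2 * E)) + choose₂ k + (EK + σ) + (a + (d * k + d)))
           (sym (2*choose₂ d)) ⟩
    (choose₃ l + (S + 2 * E)) + choose₂ k + (EK + σ) + (2 * choose₂ d + d + (d * k + d))
      ≡⟨ step₃ (choose₃ l) S E (choose₂ k) EK σ d (choose₂ d) (d * k) ⟩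
    choose₃ l + (choose₂ d + choose₂ k + d * k) + (choose₂ d + (S + σ) + 2 * (E + (d + 0))) + EK
      ≡⟨ cong₂ (λ a b → choose₃ l + a + (choose₂ d + b + 2 * (E + (d + 0))) + EK)
           (≡.trans (sym (choose₂-+ d k)) (cong choose₂ (sym l≡))) (sym S≡) ⟩
    choose₃ l + choose₂ l
      + (choose₂ d + sumOver (λ u → choose₂ (bit (adj u v) + degreeIn L u)) L + 2 * (E + (d + 0))) + EK ∎)
    where
    open ≡-Reasoning
    l = length L
    d = degreeIn L v
    k = count (every ∖N v) L
    E = edges every L
    T = triangles every L
    S = sumOver (choose₂ ∘ degreeIn L) L
    σ = sumOver (λ u → bit (adj v u) * degreeIn L u) L
    EN = edges (adj v) L
    EK = edges (every ∖N v) L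
    Q₃ = indPoly every L 3
    Q₂ = indPoly (every ∖N v) L 2
    l≡ : l ≡ d + k
    l≡ = sym (≡.trans (count-split every (adj v) L) (count-all L))
    S≡ : sumOver (λ u → choose₂ (bit (adj u v) + degreeIn L u)) L ≡ S + σ
    S≡ = ≡.trans (sumOver-cong L (λ {u} _ → ≡.trans (choose₂-bit (adj u v) _)
           (cong (λ b → choose₂ (degreeIn L u) + bit b * degreeIn L u) (adj-sym u v)))) (sumOver-+ _ _ L)
    step₁ : ∀ Q₃ Q₂ T EN E d l EK → Q₃ + Q₂ + (T + (EN + 0) + (E + (d + 0)) * suc l) + EK
          ≡ (Q₃ + (T + E * l)) + (Q₂ + EK) + (E + EN) + (d * l + d)
    step₁ = solve-∀
    step₂ : ∀ c S E q EK σ d k → (c + (S + 2 * E)) + q + (EK + σ) + (d * (d + k) + d)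
          ≡ (c + (S + 2 * E)) + q + (EK + σ) + (d * d + (d * k + d))
    step₂ = solve-∀
    step₃ : ∀ c S E q EK σ d x y → (c + (S + 2 * E)) + q + (EK + σ) + (2 * x + d + (y + d))
          ≡ c + (x + q + y) + (x + (S + σ) + 2 * (E + (d + 0))) + EK
    step₃ = solve-∀

  -- C(d-1,2), with value 1 (not 0) at d = 0 so that it vanishes exactly for d = 1, 2.
  surplus : ℕ → ℕ
  surplus zero    = 1
  surplus (suc d) = choose₂ d

  choose₂-surplus : ∀ d → choose₂ d + 1 ≡ d + surplus d
  choose₂-surplus zero    = ≡-refl
  choose₂-surplus (suc d) = ≡.trans (+-comm (choose₂ d + d) 1) (cong suc (+-comm (choose₂ d) d))

  totalSurplus : List V → ℕ
  totalSurplus L = sumOver (surplus ∘ degreeIn L) L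

  -- The sum of C(d,2) + 1 = d + C(d-1,2) over all vertices, with the degree sum replaced by twice
  -- the number of edges. It brings `totalSurplus` into `indPoly-3`.
  sum-choose₂ : ∀ L → sumOver (choose₂ ∘ degreeIn L) L + length L ≡ 2 * edges every L + totalSurplus L
  sum-choose₂ L = begin
    sumOver (choose₂ ∘ degreeIn L) L + length L
      ≡⟨ cong (λ s → sumOver (choose₂ ∘ degreeIn L) L + s) (sym (count-all L)) ⟩
    sumOver (choose₂ ∘ degreeIn L) L + count every L
      ≡⟨ sym (sumOver-+ _ _ L) ⟩
    sumOver (λ v → choose₂ (degreeIn L v) + 1) L
      ≡⟨ sumOver-cong L (λ {v} _ → choose₂-surplus (degreeIn L v)) ⟩
    sumOver (λ v → degreeIn L v + surplus (degreeIn L v)) L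
      ≡⟨ sumOver-+ _ _ L ⟩
    sumOver (degreeIn L) L + totalSurplus L
      ≡⟨ cong (_+ totalSurplus L) (sum-degrees L) ⟩
    2 * edges every L + totalSurplus L ∎
    where open ≡-Reasoning

  NoEdges : List V → List V → Set
  NoEdges A B = ∀ {a b} → a ∈ A → b ∈ B → adj a b ≡ false

  NoEdges-sym : ∀ {A B} → NoEdges A B → NoEdges B A
  NoEdges-sym sep b∈B a∈A = ≡.trans (adj-sym _ _) (sep a∈A b∈B)

  edges-none : ∀ f L → (∀ {v} → v ∈ L → f v ≡ false) → edges f L ≡ 0
  edges-none f []      h = ≡-refl
  edges-none f (v ∷ L) h rewrite h (here ≡-refl) = ≡.trans (+-identityʳ _) (edges-none f L (h ∘ there))

  edges-++ : ∀ f A B → NoEdges A B → edges f (A ++ B) ≡ edges f A + edges f B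
  edges-++ f []      B sep = ≡-refl
  edges-++ f (v ∷ A) B sep = begin
    edges f (A ++ B) + bit (f v) * count (f ∩N v) (A ++ B)
      ≡⟨ cong₂ (λ a b → a + bit (f v) * b) (edges-++ f A B (sep ∘ there))
           (≡.trans (sumOver-++ _ A B) (cong (λ s → count (f ∩N v) A + s)
             (false⇒count≡0 (f ∩N v) B (λ {b} b∈B →
               ≡.trans (cong (f b ∧_) (sep (here ≡-refl) b∈B)) (∧-zeroʳ (f b)))))) ⟩
    edges f A + edges f B + bit (f v) * (count (f ∩N v) A + 0)
      ≡⟨ tidy (edges f A) (edges f B) (bit (f v)) _ ⟩
    edges f A + bit (f v) * count (f ∩N v) A + edges f B ∎
    where
    open ≡-Reasoning
    tidy : ∀ a b c d → a + b + c * (d + 0) ≡ a + c * d + b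
    tidy = solve-∀

  triangles-++ : ∀ f A B → NoEdges A B → triangles f (A ++ B) ≡ triangles f A + triangles f B
  triangles-++ f []      B sep = ≡-refl
  triangles-++ f (v ∷ A) B sep = begin
    triangles f (A ++ B) + bit (f v) * edges (f ∩N v) (A ++ B)
      ≡⟨ cong₂ (λ a b → a + bit (f v) * b) (triangles-++ f A B (sep ∘ there))
           (≡.trans (edges-++ (f ∩N v) A B (sep ∘ there)) (cong (λ s → edges (f ∩N v) A + s)
             (edges-none (f ∩N v) B (λ {b} b∈B →
               ≡.trans (cong (f b ∧_) (sep (here ≡-refl) b∈B)) (∧-zeroʳ (f b)))))) ⟩
    triangles f A + triangles f B + bit (f v) * (edges (f ∩N v) A + 0)
      ≡⟨ tidy (triangles f A) (triangles f B) (bit (f v)) _ ⟩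
    triangles f A + bit (f v) * edges (f ∩N v) A + triangles f B ∎
    where
    open ≡-Reasoning
    tidy : ∀ a b c d → a + b + c * (d + 0) ≡ a + c * d + b
    tidy = solve-∀

  totalSurplus-++ : ∀ A B → NoEdges A B → totalSurplus (A ++ B) ≡ totalSurplus A + totalSurplus B
  totalSurplus-++ A B sep = ≡.trans (sumOver-++ _ A B) (cong₂ _+_
    (sumOver-cong A (λ {a} a∈A → cong surplus (≡.trans (sumOver-++ _ A B)
      (≡.trans (cong (λ s → degreeIn A a + s) (false⇒count≡0 (adj a) B (sep a∈A))) (+-identityʳ _)))))
    (sumOver-cong B (λ {b} b∈B → cong surplus (≡.trans (sumOver-++ _ A B)
      (cong (_+ degreeIn B b) (false⇒count≡0 (adj b) A (NoEdges-sym sep b∈B)))))))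

  ∖N-away : ∀ f v B → (∀ {b} → b ∈ B → adj v b ≡ false) → ∀ {b} → b ∈ B → (f ∖N v) b ≡ f b
  ∖N-away f v B sep {b} b∈B = ≡.trans (cong (λ c → f b ∧ not c) (sep b∈B)) (∧-identityʳ (f b))

  indPoly-++ : ∀ f A B → NoEdges A B → ∀ j → indPoly f (A ++ B) j ≡ conv (indPoly f A) (indPoly f B) j
  indPoly-++ f A       B sep zero = ≡-refl
  indPoly-++ f []      B sep (suc j) = sym (≡.trans
    (cong₂ _+_ (*-identityˡ _) (conv-zero (indPoly f B) j)) (+-identityʳ _))
  indPoly-++ f (v ∷ A) B sep (suc j)
    rewrite indPoly-++ f A B (sep ∘ there) (suc j) | indPoly-++ (f ∖N v) A B (sep ∘ there) j = begin
    1 * indPoly f B (suc j) + conv (indPoly f A ∘ suc) (indPoly f B) j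
      + (if f v then conv (indPoly (f ∖N v) A) (indPoly (f ∖N v) B) j else 0)
        ≡⟨ +-assoc (1 * indPoly f B (suc j)) _ _ ⟩
    1 * indPoly f B (suc j) + (conv (indPoly f A ∘ suc) (indPoly f B) j
      + (if f v then conv (indPoly (f ∖N v) A) (indPoly (f ∖N v) B) j else 0))
        ≡⟨ cong (λ a → 1 * indPoly f B (suc j) + (conv (indPoly f A ∘ suc) (indPoly f B) j + a)) (shifted (f v)) ⟩
    1 * indPoly f B (suc j) + (conv (indPoly f A ∘ suc) (indPoly f B) j
      + conv (λ i → if f v then indPoly (f ∖N v) A i else 0) (indPoly f B) j)
        ≡⟨ cong (λ s → 1 * indPoly f B (suc j) + s) (sym (conv-+ _ _ _ (indPoly f B) (λ _ → ≡-refl) j)) ⟩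
    1 * indPoly f B (suc j) + conv (indPoly f (v ∷ A) ∘ suc) (indPoly f B) j ∎
    where
    open ≡-Reasoning
    shifted : ∀ b → (if b then conv (indPoly (f ∖N v) A) (indPoly (f ∖N v) B) j else 0)
                  ≡ conv (λ i → if b then indPoly (f ∖N v) A i else 0) (indPoly f B) j
    shifted true  = conv-cong (λ _ → ≡-refl)
                      (indPoly-cong B (∖N-away f v B (λ b∈B → sep (here ≡-refl) b∈B))) j
    shifted false = sym (conv-zero (indPoly f B) j)

  evalOn : (V → Bool) → List V → ℤ
  evalOn f L = eval (length L) (indPoly f L)

  evalOn-∷ : ∀ f v L → evalOn f (v ∷ L) ≡
             pos 4 ℤ.* evalOn f L ℤ.- (if f v then evalOn (f ∖N v) L else pos 0)
  evalOn-∷ f v L = begin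
    eval (suc l) (indPoly f (v ∷ L))
      ≡⟨ eval-shift l (indPoly f (v ∷ L)) (indPoly f L) (λ i → if f v then indPoly (f ∖N v) L i else 0)
           (sym (indPoly-0 f L)) (λ _ → ≡-refl) ⟩
    eval (suc l) (indPoly f L) ℤ.- eval l (λ i → if f v then indPoly (f ∖N v) L i else 0)
      ≡⟨ cong₂ ℤ._-_ (eval-suc l (indPoly f L) (indPoly-degree f L (suc l) ≤-refl)) (byCases (f v)) ⟩
    pos 4 ℤ.* evalOn f L ℤ.- (if f v then evalOn (f ∖N v) L else pos 0) ∎
    where
    open ≡-Reasoning
    l = length L
    eval-zero : ∀ s → eval s (λ _ → 0) ≡ pos 0
    eval-zero zero    = ≡-refl
    eval-zero (suc s) = cong₂ (λ x y → pos x ℤ.- y) (*-zeroʳ (4 ^ suc s)) (eval-zero s)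
    byCases : ∀ b → eval l (λ i → if b then indPoly (f ∖N v) L i else 0)
                  ≡ (if b then evalOn (f ∖N v) L else pos 0)
    byCases true  = ≡-refl
    byCases false = eval-zero l

  evalOn-cong : ∀ {f g} L → (∀ {v} → v ∈ L → f v ≡ g v) → evalOn f L ≡ evalOn g L
  evalOn-cong L eq = eval-cong (length L) (indPoly-cong L eq)

  -- Both sides obey the recursion `evalOn-∷` in `A`. The scaling `4 ^ length` is itself
  -- multiplicative, so no correction factor appears.
  evalOn-++ : ∀ f A B → NoEdges A B → evalOn f (A ++ B) ≡ evalOn f A ℤ.* evalOn f B
  evalOn-++ f []      B sep = sym (ℤ.*-identityˡ _)
  evalOn-++ f (v ∷ A) B sep = begin
    evalOn f (v ∷ A ++ B)
      ≡⟨ evalOn-∷ f v (A ++ B) ⟩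
    pos 4 ℤ.* evalOn f (A ++ B) ℤ.- (if f v then evalOn (f ∖N v) (A ++ B) else pos 0)
      ≡⟨ cong₂ (λ a b → pos 4 ℤ.* a ℤ.- b) (evalOn-++ f A B (sep ∘ there)) (byCases (f v)) ⟩
    pos 4 ℤ.* (evalOn f A ℤ.* evalOn f B) ℤ.- (if f v then evalOn (f ∖N v) A else pos 0) ℤ.* evalOn f B
      ≡⟨ tidy (evalOn f A) (evalOn f B) (if f v then evalOn (f ∖N v) A else pos 0) ⟩
    (pos 4 ℤ.* evalOn f A ℤ.- (if f v then evalOn (f ∖N v) A else pos 0)) ℤ.* evalOn f B
      ≡⟨ cong (ℤ._* evalOn f B) (sym (evalOn-∷ f v A)) ⟩
    evalOn f (v ∷ A) ℤ.* evalOn f B ∎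
    where
    open ≡-Reasoning
    byCases : ∀ b → (if b then evalOn (f ∖N v) (A ++ B) else pos 0)
                  ≡ (if b then evalOn (f ∖N v) A else pos 0) ℤ.* evalOn f B
    byCases true  = ≡.trans (evalOn-++ (f ∖N v) A B (sep ∘ there))
      (cong (evalOn (f ∖N v) A ℤ.*_) (evalOn-cong B (∖N-away f v B (λ b∈B → sep (here ≡-refl) b∈B))))
    byCases false = sym (ℤ.*-zeroˡ (evalOn f B))
    tidy : ∀ a b c → pos 4 ℤ.* (a ℤ.* b) ℤ.- c ℤ.* b ≡ (pos 4 ℤ.* a ℤ.- c) ℤ.* b
    tidy = ℤRing.solve-∀

  evalOn-↭ : ∀ f {L L′} → L ↭ L′ → evalOn f L ≡ evalOn f L′
  evalOn-↭ f {L} p =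
    ≡.trans (eval-cong (length L) (indPoly-↭ p f)) (cong (λ l → eval l (indPoly f _)) (↭-length p))

-- Paths, cycles, tadpoles and connected components

module Structure {V : Set} (adj : V → V → Bool)
         (adj-sym : ∀ u v → adj u v ≡ adj v u) (adj-irr : ∀ v → adj v v ≡ false) where
  open Independence adj adj-sym adj-irr

  data PathList : List V → Set where
    empty  : PathList []
    single : ∀ x → PathList [ x ]
    step   : ∀ {x y L} → adj x y ≡ true → (∀ {z} → z ∈ L → adj x z ≡ false) →
             PathList (y ∷ L) → PathList (x ∷ y ∷ L)

  -- The head `x` closes an induced path. Its ends `h` and `z` are different positions, so there are
  -- at least three vertices.
  data CycleList : List V → Set where
    close : ∀ {x h z} M → PathList (h ∷ M ++ [ z ]) → adj x h ≡ true → adj x z ≡ true →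
            (∀ {u} → u ∈ M → adj x u ≡ false) → CycleList (x ∷ h ∷ M ++ [ z ])

  -- The vertices of D_n in the order u_n, …, u₂, u₁.
  data TadpoleList : List V → Set where
    triangle : ∀ {c b a} → adj c b ≡ true → adj c a ≡ true → adj b a ≡ true →
               TadpoleList (c ∷ b ∷ a ∷ [])
    step     : ∀ {x y L} → adj x y ≡ true → (∀ {z} → z ∈ L → adj x z ≡ false) →
               TadpoleList (y ∷ L) → TadpoleList (x ∷ y ∷ L)

  indPoly-drop : ∀ f {v} L → f v ≡ false → ∀ j → indPoly f (v ∷ L) j ≡ indPoly f L j
  indPoly-drop f L fv zero    = sym (indPoly-0 f L)
  indPoly-drop f L fv (suc j) rewrite fv = +-identityʳ _

  indPoly-pendant : ∀ {x y L} → adj x y ≡ true → (∀ {z} → z ∈ L → adj x z ≡ false) → ∀ j →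
    indPoly every (x ∷ y ∷ L) (suc j) ≡ indPoly every (y ∷ L) (suc j) + indPoly every L j
  indPoly-pendant {x} {y} {L} xy xL j = cong (λ a → indPoly every (y ∷ L) (suc j) + a)
    (≡.trans (indPoly-drop (every ∖N x) L (cong not xy) j)
             (indPoly-cong L (λ z∈L → cong not (xL z∈L)) j))

  path-tail : ∀ {x L} → PathList (x ∷ L) → PathList L
  path-tail (single _)   = empty
  path-tail (step _ _ p) = p

  indPoly-path : ∀ {L} → PathList L → ∀ j → indPoly every L j ≡ pathPoly (length L) j
  indPoly-path {L} p zero = ≡.trans (indPoly-0 every L) (sym (pathPoly-0 (length L)))
  indPoly-path empty      (suc j)       = ≡-refl
  indPoly-path (single x) (suc zero)    = ≡-refl
  indPoly-path (single x) (suc (suc j)) = ≡-refl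
  indPoly-path (step {L = L} xy xL p) (suc j) =
    ≡.trans (indPoly-pendant xy xL j) (cong₂ _+_ (indPoly-path p (suc j)) (indPoly-path (path-tail p) j))

  path-init : ∀ L {z} → PathList (L ++ [ z ]) → PathList L
  path-init []          p               = empty
  path-init (x ∷ [])    p               = single x
  path-init (x ∷ y ∷ L) (step xy xL p)  = step xy (xL ∘ ∈-++⁺ˡ) (path-init (y ∷ L) p)

  -- Without `x` the path from `h` to `z` remains. With `x` both `h` and `z` are excluded, and `M`
  -- is a path on n - 3 vertices.
  indPoly-cycle : ∀ {L} → CycleList L → ∀ j → indPoly every L j ≡ cyclePoly (length L) j
  indPoly-cycle (close M p xh xz xM) zero = ≡-refl
  indPoly-cycle (close {x} {h} {z} M p xh xz xM) (suc j) = begin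
    indPoly every (h ∷ M ++ [ z ]) (suc j) + indPoly (every ∖N x) (h ∷ M ++ [ z ]) j
      ≡⟨ cong₂ _+_ (indPoly-path p (suc j)) (begin
           indPoly (every ∖N x) (h ∷ M ++ [ z ]) j
             ≡⟨ indPoly-drop (every ∖N x) (M ++ [ z ]) (cong not xh) j ⟩
           indPoly (every ∖N x) (M ++ [ z ]) j
             ≡⟨ indPoly-↭ (↭-sym (∷↭∷ʳ z M)) (every ∖N x) j ⟩
           indPoly (every ∖N x) (z ∷ M) j
             ≡⟨ indPoly-drop (every ∖N x) M (cong not xz) j ⟩
           indPoly (every ∖N x) M j
             ≡⟨ indPoly-cong M (λ u∈M → cong not (xM u∈M)) j ⟩
           indPoly every M j
             ≡⟨ indPoly-path (path-init M (path-tail p)) j ⟩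
           pathPoly (length M) j ∎) ⟩
    pathPoly (length (h ∷ M ++ [ z ])) (suc j) + pathPoly (length M) j
      ≡⟨ cong (λ m → pathPoly (suc m) (suc j) + pathPoly (length M) j) len ⟩
    cyclePoly (3 + length M) (suc j)
      ≡⟨ cong (λ m → cyclePoly (2 + m) (suc j)) (sym len) ⟩
    cyclePoly (length (x ∷ h ∷ M ++ [ z ])) (suc j) ∎
    where
    open ≡-Reasoning
    len : length (M ++ [ z ]) ≡ suc (length M)
    len = ≡.trans (length-++ M) (+-comm (length M) 1)

  cyclePoly-rec : ∀ m j → cyclePoly (5 + m) (suc j) ≡ cyclePoly (4 + m) (suc j) + cyclePoly (3 + m) j
  cyclePoly-rec m zero    rewrite pathPoly-0 m = ≡-refl
  cyclePoly-rec m (suc j) = tidy (pathPoly (3 + m) (2 + j)) _ _ _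
    where
    tidy : ∀ a b c d → a + b + (c + d) ≡ a + c + (b + d)
    tidy = solve-∀

  tadpole-length : ∀ {L} → TadpoleList L → 3 ≤ length L
  tadpole-length (triangle _ _ _) = s≤s (s≤s (s≤s z≤n))
  tadpole-length (step _ _ p)     = m≤n⇒m≤1+n (tadpole-length p)

  -- Stripping the end of the tail yields the recurrence that `cyclePoly-rec` gives for cycles. The
  -- base cases are D_3 = C_3 and D_4; in D_4, removing the end and its neighbour leaves a single
  -- edge, which takes the place of a smaller tadpole.
  indPoly-tadpole : ∀ {L} → TadpoleList L → ∀ j → indPoly every L j ≡ cyclePoly (length L) j
  indPoly-tadpole {x ∷ L} p zero = ≡-refl
  indPoly-tadpole (triangle {c} {b} {a} cb ca ba) (suc j) = tri j
    where
    tri : ∀ j → indPoly every (c ∷ b ∷ a ∷ []) (suc j) ≡ cyclePoly 3 (suc j)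
    tri zero          = ≡-refl
    tri (suc zero)    rewrite cb | ca | ba = ≡-refl
    tri (suc (suc j)) rewrite cb | ca | ba = ≡-refl
  indPoly-tadpole (step {x} xc xL (triangle {c} {b} {a} cb ca ba)) (suc j) =
    ≡.trans (indPoly-pendant xc xL j)
      (≡.trans (cong (λ u → u + indPoly every (b ∷ a ∷ []) j) (indPoly-tadpole (triangle cb ca ba) (suc j))) (base j))
    where
    base : ∀ j → cyclePoly 3 (suc j) + indPoly every (b ∷ a ∷ []) j ≡ cyclePoly 4 (suc j)
    base zero             = ≡-refl
    base (suc zero)       = ≡-refl
    base (suc (suc zero)) rewrite ba = ≡-refl
    base (suc (suc (suc j))) rewrite ba = ≡-refl
  indPoly-tadpole (step {L = y ∷ L} xy xL (step yz yL p)) (suc j) =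
    ≡.trans (indPoly-pendant xy xL j) (≡.trans
      (cong₂ _+_ (indPoly-tadpole (step yz yL p) (suc j)) (indPoly-tadpole p j))
      (rec (tadpole-length p)))
    where
    rec : ∀ {n} → 3 ≤ n → cyclePoly (suc n) (suc j) + cyclePoly n j ≡ cyclePoly (2 + n) (suc j)
    rec (s≤s (s≤s (s≤s {n = m} _))) = sym (cyclePoly-rec m j)

  -- The list records a search that starts at its last entry and adds each new vertex at the front,
  -- next to a vertex already found. Induction over a connected graph becomes induction on this
  -- list.
  data Connected : List V → Set where
    single : ∀ x → Connected [ x ]
    attach : ∀ {x y L} → y ∈ L → adj x y ≡ true → Connected L → Connected (x ∷ L)

  data Separated : List (List V) → Set where
    []  : Separated []
    _∷_ : ∀ {A As} → NoEdges A (concat As) → Separated As → Separated (A ∷ As)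

  find-attached : ∀ L R → (∃₂ λ x R′ → ∃ λ y → R ↭ x ∷ R′ × y ∈ L × adj x y ≡ true) ⊎ NoEdges L R
  find-attached L [] = inj₂ (λ _ ())
  find-attached L (x ∷ R) with any? (λ y → adj x y Bool.≟ true) L
  ... | yes q = let y , y∈L , xy = find q in inj₁ (x , R , y , refl , y∈L , xy)
  ... | no ¬q with find-attached L R
  ...   | inj₁ (x′ , R′ , y , p , y∈L , xy) =
            inj₁ (x′ , x ∷ R′ , y , trans (prep x p) (swap x x′ refl) , y∈L , xy)
  ...   | inj₂ sep = inj₂ λ
            { u∈L (here ≡-refl) → ≡.trans (adj-sym _ _) (¬-not (λ xy → ¬q (lose u∈L xy)))
            ; u∈L (there v∈R)   → sep u∈L v∈R }

  -- `L` absorbs adjacent vertices until nothing outside touches it; `n` is fuel. The final length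
  -- bound supplies the fuel for `components`.
  component : ∀ n L R → length R ≤ n → Connected L →
              ∃₂ λ A R′ → Connected A × NoEdges A R′ × A ++ R′ ↭ L ++ R × length R′ ≤ length R
  component n L R R≤n c with find-attached L R
  ... | inj₂ sep = L , R , c , sep , refl , ≤-refl
  component zero L R R≤n c | inj₁ (x , R′ , y , p , y∈L , xy) =
    ⊥-elim (n≮0 (subst (_≤ 0) (↭-length p) R≤n))
  component (suc n) L R R≤n c | inj₁ (x , R′ , y , p , y∈L , xy)
    with component n (x ∷ L) R′ (s≤s⁻¹ (subst (_≤ suc n) (↭-length p) R≤n)) (attach y∈L xy c)
  ... | A , R″ , cA , sep , q , R″≤ =
        A , R″ , cA , sep
          , ↭-trans q (↭-trans (↭-sym (shift x L R′)) (++⁺ˡ L (↭-sym p)))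
          , ≤-trans R″≤ (subst (length R′ ≤_) (sym (↭-length p)) (n≤1+n _))

  components : ∀ n R → length R ≤ n → ∃ λ As → All Connected As × Separated As × concat As ↭ R
  components n [] _ = [] , [] , [] , refl
  components (suc n) (x ∷ R) (s≤s R≤n) with component n [ x ] R R≤n (single x)
  ... | A , R′ , cA , sep , p , R′≤ with components n R′ (≤-trans R′≤ R≤n)
  ...   | As , cAs , seps , q =
          A ∷ As , cA ∷ cAs , (λ a∈A b∈ → sep a∈A (∈-resp-↭ q b∈)) ∷ seps
            , ↭-trans (++⁺ˡ A q) p

  uncons-↭-++ : ∀ {x : V} {A} S R → x ∷ A ↭ S ++ R →
                (∃ λ S′ → S ↭ x ∷ S′ × A ↭ S′ ++ R) ⊎ (∃ λ R′ → R ↭ x ∷ R′ × A ↭ S ++ R′)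
  uncons-↭-++ {x} S R p with ∈-++⁻ S (∈-resp-↭ p (here ≡-refl))
  ... | inj₁ x∈S = let S′ , q = extract x∈S in
                   inj₁ (S′ , q , drop-∷ (↭-trans p (++⁺ʳ R q)))
  ... | inj₂ x∈R = let R′ , q = extract x∈R in
                   inj₂ (R′ , q , drop-∷ (↭-trans p (↭-trans (++⁺ˡ S q) (shift x S R′))))

  -- The vertex found last lies on the same side as its neighbour found earlier, so it can be
  -- removed and induction applies. This is the stopping criterion of all listings below: a nonempty
  -- piece without edges to the rest is everything.
  connected-split : ∀ {A} → Connected A → ∀ {s S R} → A ↭ (s ∷ S) ++ R → NoEdges (s ∷ S) R → R ≡ []
  connected-split (single x) {S = []}    {[]}    p sep = ≡-refl
  connected-split (single x) {S = []}    {r ∷ R} p sep = case ↭-length p of λ ()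
  connected-split (single x) {S = s ∷ S} {R}     p sep = case ↭-length p of λ ()
  connected-split (attach {x} {y} y∈A xy c) {s} {S} {R} p sep with uncons-↭-++ (s ∷ S) R p
  ... | inj₁ ([] , q , A↭) = ⊥-elim (case
          ≡.trans (sym xy) (sep (∈-resp-↭ (↭-sym q) (here ≡-refl)) (∈-resp-↭ A↭ y∈A)) of λ ())
  ... | inj₁ (s′ ∷ S′ , q , A↭) = connected-split c A↭
          (λ a∈ b∈ → sep (∈-resp-↭ (↭-sym q) (there a∈)) b∈)
  ... | inj₂ (R′ , q , A↭)
      with connected-split c A↭ (λ a∈ b∈ → sep a∈ (∈-resp-↭ (↭-sym q) (there b∈)))
  ...   | ≡-refl = ⊥-elim (case
          ≡.trans (sym xy) (≡.trans (adj-sym _ _)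
            (sep (subst (y ∈_) (++-identityʳ (s ∷ S)) (∈-resp-↭ A↭ y∈A))
                 (∈-resp-↭ (↭-sym q) (here ≡-refl)))) of λ ())

  Tree Unicyclic : List V → Set
  Tree L      = suc (edges every L) ≡ length L × triangles every L ≡ 0
  Unicyclic L = edges every L ≡ length L × triangles every L ≤ 1

  -- A new vertex of degree d ≥ 1 brings d edges, and one triangle for each edge among its
  -- neighbours, hence at most C(d,2). So d = 1 preserves each alternative, d = 2 turns a tree into
  -- a unicyclic graph with at most one triangle, and everything else leaves more edges than
  -- vertices.
  connected-edges : ∀ {L} → Connected L → Tree L ⊎ Unicyclic L ⊎ length L < edges every L
  connected-edges (single x) = inj₁ (≡-refl , ≡-refl)
  connected-edges (attach {x} {y} {L} y∈L xy c)
    with degreeIn L x | edges≤choose₂ (adj x) L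
       | subst (_≤ degreeIn L x) (cong bit xy) (sumOver-∈ (bit ∘ adj x) y∈L)
       | connected-edges c
  ... | 1 | EN | _ | inj₁ (e , t) rewrite n≤0⇒n≡0 EN =
          inj₁ (cong suc (≡.trans (+-comm _ 1) e) , ≡.trans (+-identityʳ _) t)
  ... | 1 | EN | _ | inj₂ (inj₁ (e , t)) rewrite n≤0⇒n≡0 EN =
          inj₂ (inj₁ (≡.trans (+-comm _ 1) (cong suc e) , subst (_≤ 1) (sym (+-identityʳ _)) t))
  ... | 1 | EN | _ | inj₂ (inj₂ e) = inj₂ (inj₂ (subst (suc (length L) <_) (+-comm 1 _) (s≤s e)))
  ... | 2 | EN | _ | inj₁ (e , t) = inj₂ (inj₁
          (≡.trans (+-comm _ 2) (cong suc e) ,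
           subst (λ a → a + (edges (adj x) L + 0) ≤ 1) (sym t) (subst (_≤ 1) (sym (+-identityʳ _)) EN)))
  ... | 2 | EN | _ | inj₂ (inj₁ (e , t)) = inj₂ (inj₂ (subst (suc (length L) <_) (+-comm 2 _)
          (s≤s (s≤s (≤-reflexive (sym e))))))
  ... | 2 | EN | _ | inj₂ (inj₂ e) = inj₂ (inj₂ (subst (suc (length L) <_) (+-comm 2 _)
          (s≤s (m≤n⇒m≤1+n e))))
  ... | suc (suc (suc d)) | EN | _ | r = inj₂ (inj₂ (subst (suc (length L) <_) (+-comm (3 + (d + 0)) _)
          (s≤s (s≤s (≤-trans (bound r) (+-monoʳ-≤ 1 (m≤n+m _ (d + 0))))))))
    where
    bound : Tree L ⊎ Unicyclic L ⊎ length L < edges every L → length L ≤ suc (edges every L)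
    bound (inj₁ (e , _))        = ≤-reflexive (sym e)
    bound (inj₂ (inj₁ (e , _))) = m≤n⇒m≤1+n (≤-reflexive (sym e))
    bound (inj₂ (inj₂ e))       = m≤n⇒m≤1+n (<⇒≤ e)

-- Listing the vertices of a component as a cycle or a tadpole

module Listing {V : Set} (adj : V → V → Bool)
         (adj-sym : ∀ u v → adj u v ≡ adj v u) (adj-irr : ∀ v → adj v v ≡ false) where
  open Independence adj adj-sym adj-irr
  open Structure adj adj-sym adj-irr

  degreeIn-↭ : ∀ {A B} v → A ↭ B → degreeIn A v ≡ degreeIn B v
  degreeIn-↭ v = sumOver-↭ (bit ∘ adj v)

  noEdges : ∀ {S R} → (∀ {u} → u ∈ S → degreeIn R u ≡ 0) → NoEdges S R
  noEdges h u∈S v∈R = count≡0⇒false (adj _) (h u∈S) v∈R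

  rotate : ∀ {A L R R′ : List V} {x} → A ↭ L ++ R → R ↭ x ∷ R′ → A ↭ x ∷ L ++ R′
  rotate {L = L} {R′ = R′} {x} p q = ↭-trans p (↭-trans (++⁺ˡ L q) (shift x L R′))

  -- An induced path grows at `h` while `z` stays fixed; inner vertices are saturated and each end
  -- lacks one neighbour. The missing neighbour `x` of `h` either is adjacent to `z`, which closes
  -- the cycle and saturates all listed vertices, or becomes the new end. `n` is fuel.
  cycle-extend : ∀ {A} → Connected A → (∀ {v} → v ∈ A → degreeIn A v ≡ 2) →
    ∀ n h M z R → length R ≤ n → PathList (h ∷ M ++ [ z ]) → A ↭ (h ∷ M ++ [ z ]) ++ R →
    (∀ {u} → u ∈ M → degreeIn R u ≡ 0) → degreeIn R h ≡ 1 → degreeIn R z ≡ 1 →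
    ∃ λ S → S ↭ A × CycleList S
  cycle-extend {A} cA deg2 n h M z R R≤n path A↭ M0 h1 z1
    with count⇒extract (adj h) R (≤-reflexive (sym h1))
  ... | x , R′ , R↭ , hx = go n R≤n (adj z x) ≡-refl
    where
    A↭′ : A ↭ (x ∷ h ∷ M ++ [ z ]) ++ R′
    A↭′ = rotate {L = h ∷ M ++ [ z ]} A↭ R↭
    xh : adj x h ≡ true
    xh = ≡.trans (adj-sym x h) hx
    deg-R : ∀ u → degreeIn R u ≡ bit (adj u x) + degreeIn R′ u
    deg-R u = degreeIn-↭ u R↭
    xM : ∀ {u} → u ∈ M → adj x u ≡ false
    xM {u} u∈M = ≡.trans (adj-sym x u)
      (count≡0⇒false (adj u) (M0 u∈M) (∈-resp-↭ (↭-sym R↭) (here ≡-refl)))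
    h0 : degreeIn R′ h ≡ 0
    h0 = suc-injective (≡.trans (sym (≡.trans (deg-R h) (cong (λ b → bit b + degreeIn R′ h) hx))) h1)
    M0′ : ∀ {u} → u ∈ M → degreeIn R′ u ≡ 0
    M0′ {u} u∈M = m+n≡0⇒n≡0 (bit (adj u x)) (≡.trans (sym (deg-R u)) (M0 u∈M))
    -- One of the two neighbours of `x` is `h` and none lies in `M`, so the other is `z` or still
    -- unlisted.
    deg-x : bit (adj z x) + degreeIn R′ x ≡ 1
    deg-x = suc-injective (≡.trans (sym (begin
      degreeIn A x
        ≡⟨ degreeIn-↭ x A↭′ ⟩
      bit (adj x x) + (bit (adj x h) + degreeIn ((M ++ [ z ]) ++ R′) x)
        ≡⟨ cong₂ (λ a b → bit a + (bit b + degreeIn ((M ++ [ z ]) ++ R′) x)) (adj-irr x) xh ⟩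
      suc (degreeIn ((M ++ [ z ]) ++ R′) x)
        ≡⟨ cong suc (≡.trans (sumOver-++ _ (M ++ [ z ]) R′)
                             (cong (_+ degreeIn R′ x) (sumOver-++ _ M [ z ]))) ⟩
      suc (degreeIn M x + (bit (adj x z) + 0) + degreeIn R′ x)
        ≡⟨ cong₂ (λ a b → suc (a + (bit b + 0) + degreeIn R′ x)) (false⇒count≡0 (adj x) M xM) (adj-sym x z) ⟩
      suc (bit (adj z x) + 0 + degreeIn R′ x)
        ≡⟨ cong (λ a → suc (a + degreeIn R′ x)) (+-identityʳ _) ⟩
      suc (bit (adj z x) + degreeIn R′ x) ∎)) (deg2 (∈-resp-↭ (↭-sym A↭′) (here ≡-refl))))
      where open ≡-Reasoning
    z-split : bit (adj z x) + degreeIn R′ z ≡ 1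
    z-split = ≡.trans (sym (deg-R z)) z1
    go : ∀ n → length R ≤ n → ∀ b → adj z x ≡ b → ∃ λ S → S ↭ A × CycleList S
    go n R≤n true zx = S , ↭-sym A↭S , close M path xh (≡.trans (adj-sym x z) zx) xM
      where
      S = x ∷ h ∷ M ++ [ z ]
      zero-x : degreeIn R′ x ≡ 0
      zero-x = suc-injective (subst (λ b → bit b + degreeIn R′ x ≡ 1) zx deg-x)
      zero-z : degreeIn R′ z ≡ 0
      zero-z = suc-injective (subst (λ b → bit b + degreeIn R′ z ≡ 1) zx z-split)
      zero-Mz : ∀ {u} → u ∈ M ++ [ z ] → degreeIn R′ u ≡ 0
      zero-Mz u∈ with ∈-++⁻ M u∈
      ... | inj₁ u∈M           = M0′ u∈M
      ... | inj₂ (here ≡-refl) = zero-z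
      saturated : ∀ {u} → u ∈ S → degreeIn R′ u ≡ 0
      saturated (here ≡-refl)         = zero-x
      saturated (there (here ≡-refl)) = h0
      saturated (there (there u∈))    = zero-Mz u∈
      A↭S : A ↭ S
      A↭S = ↭-trans A↭′ (↭-reflexive (≡.trans
        (cong (S ++_) (connected-split cA A↭′ (noEdges saturated))) (++-identityʳ S)))
    go zero R≤0 false zx = ⊥-elim (n≮0 (subst (_≤ 0) (↭-length R↭) R≤0))
    go (suc n) R≤n false zx =
      cycle-extend cA deg2 n x (h ∷ M) z R′ (s≤s⁻¹ (subst (_≤ suc n) (↭-length R↭) R≤n))
        (step xh xMz path) A↭′
        (λ { (here ≡-refl) → h0 ; (there u∈M) → M0′ u∈M })
        (subst (λ b → bit b + degreeIn R′ x ≡ 1) zx deg-x)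
        (subst (λ b → bit b + degreeIn R′ z ≡ 1) zx z-split)
      where
      xMz : ∀ {u} → u ∈ M ++ [ z ] → adj x u ≡ false
      xMz u∈ with ∈-++⁻ M u∈
      ... | inj₁ u∈M           = xM u∈M
      ... | inj₂ (here ≡-refl) = ≡.trans (adj-sym x z) zx

  cycle-listing : ∀ {A} → Connected A → (∀ {v} → v ∈ A → degreeIn A v ≡ 2) →
                  ∃ λ S → S ↭ A × CycleList S
  cycle-listing {[]} () deg2
  cycle-listing {z ∷ R} cA deg2 with count⇒extract (adj z) R (subst (1 ≤_) (sym deg-z) (s≤s z≤n))
    where
    deg-z : degreeIn R z ≡ 2
    deg-z = ≡.trans (cong (λ b → bit b + degreeIn R z) (sym (adj-irr z))) (deg2 (here ≡-refl))
  ... | h , R′ , R↭ , zh =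
    cycle-extend cA deg2 (length R′) h [] z R′ ≤-refl (step hz (λ ()) (single z)) A↭ (λ ())
      (suc-injective h2) (suc-injective z2)
    where
    hz : adj h z ≡ true
    hz = ≡.trans (adj-sym h z) zh
    A↭ : z ∷ R ↭ h ∷ z ∷ R′
    A↭ = ↭-trans (prep z R↭) (swap z h refl)
    h2 : suc (degreeIn R′ h) ≡ 2
    h2 = ≡.trans (≡.trans (cong₂ (λ a b → bit a + (bit b + degreeIn R′ h)) (sym (adj-irr h)) (sym hz))
           (sym (degreeIn-↭ h A↭))) (deg2 (∈-resp-↭ (↭-sym A↭) (here ≡-refl)))
    z2 : suc (degreeIn R′ z) ≡ 2
    z2 = ≡.trans (≡.trans (cong₂ (λ a b → bit a + (bit b + degreeIn R′ z)) (sym zh) (sym (adj-irr z)))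
           (sym (degreeIn-↭ z A↭))) (deg2 (here ≡-refl))

  -- Only the tip `h` of the tail may have a neighbour outside, and at most one. If there is none,
  -- the listing is complete by connectedness; otherwise that neighbour has degree at most 2 and is
  -- the new tip.
  tadpole-extend : ∀ {A} → Connected A →
    ∀ n h L R → length R ≤ n → TadpoleList (h ∷ L) → A ↭ (h ∷ L) ++ R →
    (∀ {u} → u ∈ L → degreeIn R u ≡ 0) → degreeIn R h ≤ 1 →
    (∀ {v} → v ∈ R → degreeIn A v ≤ 2) → ∃ λ S → S ↭ A × TadpoleList S
  tadpole-extend {A} cA n h L R R≤n tad A↭ L0 h≤1 R≤2 with degreeIn R h in deg-h
  ... | zero = h ∷ L , ↭-sym (↭-trans A↭ (↭-reflexive (≡.trans
          (cong ((h ∷ L) ++_) (connected-split cA A↭ (noEdges saturated))) (++-identityʳ (h ∷ L))))) , tad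
    where
    saturated : ∀ {u} → u ∈ h ∷ L → degreeIn R u ≡ 0
    saturated (here ≡-refl) = deg-h
    saturated (there u∈L)   = L0 u∈L
  ... | suc (suc d) = case h≤1 of λ { (s≤s ()) }
  ... | suc zero with count⇒extract (adj h) R (≤-reflexive (sym deg-h))
  ...   | x , R′ , R↭ , hx = go n R≤n
    where
    A↭′ : A ↭ (x ∷ h ∷ L) ++ R′
    A↭′ = rotate {L = h ∷ L} A↭ R↭
    xh : adj x h ≡ true
    xh = ≡.trans (adj-sym x h) hx
    deg-R : ∀ u → degreeIn R u ≡ bit (adj u x) + degreeIn R′ u
    deg-R u = degreeIn-↭ u R↭
    xL : ∀ {u} → u ∈ L → adj x u ≡ false
    xL {u} u∈L = ≡.trans (adj-sym x u)
      (count≡0⇒false (adj u) (L0 u∈L) (∈-resp-↭ (↭-sym R↭) (here ≡-refl)))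
    hL0 : ∀ {u} → u ∈ h ∷ L → degreeIn R′ u ≡ 0
    hL0 (here ≡-refl) = suc-injective
      (≡.trans (sym (≡.trans (deg-R h) (cong (λ b → bit b + degreeIn R′ h) hx))) deg-h)
    hL0 {u} (there u∈L) = m+n≡0⇒n≡0 (bit (adj u x)) (≡.trans (sym (deg-R u)) (L0 u∈L))
    x≤1 : degreeIn R′ x ≤ 1
    x≤1 = ≤-trans (m≤n+m _ (degreeIn L x)) (s≤s⁻¹ (subst (_≤ 2) (begin
      degreeIn A x
        ≡⟨ degreeIn-↭ x A↭′ ⟩
      bit (adj x x) + (bit (adj x h) + degreeIn (L ++ R′) x)
        ≡⟨ cong₂ (λ a b → bit a + (bit b + degreeIn (L ++ R′) x)) (adj-irr x) xh ⟩
      suc (degreeIn (L ++ R′) x)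
        ≡⟨ cong suc (sumOver-++ _ L R′) ⟩
      suc (degreeIn L x + degreeIn R′ x) ∎) (R≤2 (∈-resp-↭ (↭-sym R↭) (here ≡-refl)))))
      where open ≡-Reasoning
    go : ∀ n → length R ≤ n → ∃ λ S → S ↭ A × TadpoleList S
    go zero R≤0 = ⊥-elim (n≮0 (subst (_≤ 0) (↭-length R↭) R≤0))
    go (suc n) R≤n = tadpole-extend cA n x (h ∷ L) R′ (s≤s⁻¹ (subst (_≤ suc n) (↭-length R↭) R≤n))
      (step xh xL tad) A↭′ hL0 x≤1 (λ v∈ → R≤2 (∈-resp-↭ (↭-sym R↭) (there v∈)))

  edges⇒extract : ∀ f L → 1 ≤ edges f L →
    ∃₂ λ a b → ∃ λ R → L ↭ a ∷ b ∷ R × f a ≡ true × f b ≡ true × adj a b ≡ true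
  edges⇒extract f (v ∷ L) h with edges f L in eq
  ... | suc e with edges⇒extract f L (subst (1 ≤_) (sym eq) (s≤s z≤n))
  ...   | a , b , R , p , fa , fb , ab =
          a , b , v ∷ R , ↭-trans (prep v p) (↭-sym (shift v (a ∷ b ∷ []) R)) , fa , fb , ab
  edges⇒extract f (v ∷ L) h | zero with f v in fv
  ...   | true with count⇒extract (f ∩N v) L (subst (1 ≤_) (+-identityʳ _) h)
  ...     | b , R , p , fvb = v , b , R , prep v p , fv , ∧-true₁ (f b) fvb , ∧-true₂ (f b) fvb
    where
    ∧-true₁ : ∀ a {b} → a ∧ b ≡ true → a ≡ true
    ∧-true₁ true _ = ≡-refl
    ∧-true₂ : ∀ a {b} → a ∧ b ≡ true → b ≡ true
    ∧-true₂ true e = e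

  triangles⇒extract : ∀ L → 1 ≤ triangles every L →
    ∃₂ λ a b → ∃₂ λ c R → L ↭ a ∷ b ∷ c ∷ R × adj a b ≡ true × adj a c ≡ true × adj b c ≡ true
  triangles⇒extract (v ∷ L) h with triangles every L in eq
  ... | suc t with triangles⇒extract L (subst (1 ≤_) (sym eq) (s≤s z≤n))
  ...   | a , b , c , R , p , ab , ac , bc =
          a , b , c , v ∷ R , ↭-trans (prep v p) (↭-sym (shift v (a ∷ b ∷ c ∷ []) R)) , ab , ac , bc
  triangles⇒extract (v ∷ L) h | zero with edges⇒extract (adj v) L (subst (1 ≤_) (+-identityʳ _) h)
  ...   | b , c , R , p , vb , vc , bc = v , b , c , R , prep v p , vb , vc , bc

  surplus≡0⇒degree≤2 : ∀ d → surplus d ≡ 0 → d ≤ 2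
  surplus≡0⇒degree≤2 1 _ = s≤s z≤n
  surplus≡0⇒degree≤2 2 _ = ≤-refl
  surplus≡0⇒degree≤2 (suc (suc (suc d))) h = case m+n≡0⇒n≡0 (choose₂ (suc d)) h of λ ()

  totalSurplus≡0⇒degree≤2 : ∀ A {B} → sumOver (surplus ∘ degreeIn A) B ≡ 0 →
                            ∀ {v} → v ∈ B → degreeIn A v ≤ 2
  totalSurplus≡0⇒degree≤2 A h v∈B = surplus≡0⇒degree≤2 _
    (n≤0⇒n≡0 (subst (_ ≤_) h (sumOver-∈ (surplus ∘ degreeIn A) v∈B)))

  record Triangle (A : List V) : Set where
    constructor mkTriangle
    field
      a b c : V
      R     : List V
      perm  : A ↭ a ∷ b ∷ c ∷ R
      ab    : adj a b ≡ true
      ac    : adj a c ≡ true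
      bc    : adj b c ≡ true

    -- The `surplus` of a vertex of the triangle, whose degree is `2 + degreeIn R v`.
    surplusAt : V → ℕ
    surplusAt v = choose₂ (suc (degreeIn R v))

    rest : ℕ
    rest = sumOver (surplus ∘ degreeIn A) R

    totalSurplus≡ : totalSurplus A ≡ surplusAt a + (surplusAt b + (surplusAt c + rest))
    totalSurplus≡ = ≡.trans (sumOver-↭ _ perm) (cong₂ _+_ (cong surplus deg-a) (cong₂ _+_ (cong surplus deg-b)
      (cong (λ s → surplus s + rest) deg-c)))
      where
      deg-a : degreeIn A a ≡ 2 + degreeIn R a
      deg-a rewrite degreeIn-↭ a perm | adj-irr a | ab | ac = ≡-refl
      deg-b : degreeIn A b ≡ 2 + degreeIn R b
      deg-b rewrite degreeIn-↭ b perm | adj-sym b a | adj-irr b | ab | bc = ≡-refl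
      deg-c : degreeIn A c ≡ 2 + degreeIn R c
      deg-c rewrite degreeIn-↭ c perm | adj-sym c a | adj-sym c b | adj-irr c | ac | bc = ≡-refl

  open Triangle using (totalSurplus≡)

  choose₂-suc≡0 : ∀ d → choose₂ (suc d) ≡ 0 → d ≡ 0
  choose₂-suc≡0 d h = m+n≡0⇒n≡0 (choose₂ d) h

  choose₂-suc≤1 : ∀ d → choose₂ (suc d) ≤ 1 → d ≤ 1
  choose₂-suc≤1 d h = ≤-trans (m≤n+m d (choose₂ d)) h

  -- Surplus 0 means degree 2 here, so no edge leaves the triangle and connectedness leaves no
  -- further vertex.
  closed-triangle : ∀ {A} → Connected A → (T : Triangle A) → let open Triangle T in
    surplusAt a ≡ 0 → surplusAt b ≡ 0 → surplusAt c ≡ 0 → length A ≡ 3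
  closed-triangle cA (mkTriangle a b c R perm ab ac bc) a0 b0 c0 =
    ≡.trans (↭-length perm) (cong (3 +_) (cong length (connected-split cA perm (noEdges saturated))))
    where
    saturated : ∀ {u} → u ∈ a ∷ b ∷ c ∷ [] → degreeIn R u ≡ 0
    saturated (here ≡-refl)                 = choose₂-suc≡0 _ a0
    saturated (there (here ≡-refl))         = choose₂-suc≡0 _ b0
    saturated (there (there (here ≡-refl))) = choose₂-suc≡0 _ c0

  triangle-listing : ∀ {A} → Connected A → (T : Triangle A) → let open Triangle T in
    surplusAt a ≤ 1 → surplusAt b ≡ 0 → surplusAt c ≡ 0 → rest ≡ 0 → ∃ λ S → S ↭ A × TadpoleList S
  triangle-listing {A} cA (mkTriangle a b c R perm ab ac bc) a1 b0 c0 r0 =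
    tadpole-extend cA (length R) a (b ∷ c ∷ []) R ≤-refl (triangle ab ac bc) perm
      (λ { (here ≡-refl) → choose₂-suc≡0 _ b0 ; (there (here ≡-refl)) → choose₂-suc≡0 _ c0 })
      (choose₂-suc≤1 _ a1) (totalSurplus≡0⇒degree≤2 A r0)

  rotate-triangle : ∀ {A} → Triangle A → Triangle A
  rotate-triangle (mkTriangle a b c R perm ab ac bc) = mkTriangle b c a R
    (↭-trans perm (↭-sym (shift a (b ∷ c ∷ []) R))) bc (≡.trans (adj-sym b a) ab) (≡.trans (adj-sym c a) ac)

  -- If the one possible triangle is present, some edge leaves it, since otherwise it would be the
  -- whole component, against `length A ≢ 3`. The vertex where that edge starts has positive
  -- surplus.
  triangles≤totalSurplus : ∀ {A} → Connected A → Unicyclic A → length A ≢ 3 →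
                           triangles every A ≤ totalSurplus A
  triangles≤totalSurplus {A} cA (_ , t≤1) ≢3 with triangles every A in eq
  ... | zero = z≤n
  ... | suc (suc t) = case t≤1 of λ { (s≤s ()) }
  ... | suc zero with triangles⇒extract A (≤-reflexive (sym eq)) | totalSurplus A in s
  ...   | _ | suc _ = s≤s z≤n
  ...   | a , b , c , R , perm , ab , ac , bc | zero =
          ⊥-elim (≢3 (closed-triangle cA T (m+n≡0⇒m≡0 (surplusAt a) s′)
            (m+n≡0⇒m≡0 (surplusAt b) s″)
            (m+n≡0⇒m≡0 (surplusAt c) (m+n≡0⇒n≡0 (surplusAt b) s″))))
    where
    T = mkTriangle a b c R perm ab ac bc
    open Triangle T using (surplusAt; rest)
    s′ : surplusAt a + (surplusAt b + (surplusAt c + rest)) ≡ 0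
    s′ = ≡.trans (sym (totalSurplus≡ T)) s
    s″ = m+n≡0⇒n≡0 (surplusAt a) s′

  listing : ∀ {A} → Connected A → Unicyclic A → length A ≢ 3 → triangles every A ≡ totalSurplus A →
            ∃ λ S → S ↭ A × (CycleList S ⊎ TadpoleList S)
  listing {A} cA (e , t≤1) ≢3 t≡s with triangles every A in eq
  ... | zero = let S , p , cyc = cycle-listing cA deg2 in S , p , inj₁ cyc
    where
    -- Zero surplus bounds every degree by 2, and with as many edges as vertices the degrees average
    -- 2.
    deg2 : ∀ {v} → v ∈ A → degreeIn A v ≡ 2
    deg2 = sumOver-tight (degreeIn A) (λ _ → 2) A (totalSurplus≡0⇒degree≤2 A (sym t≡s))
      (≡.trans (sum-degrees A) (≡.trans (cong (2 *_) e) (≡.trans (*-comm 2 (length A)) (sym (sumOver-const 2 A)))))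
  ... | suc (suc t) = case t≤1 of λ { (s≤s ()) }
  ... | suc zero with triangles⇒extract A (≤-reflexive (sym eq))
  ...   | a , b , c , R , perm , ab , ac , bc =
          cases (surplusAt a) (surplusAt b) (surplusAt c) rest ≡-refl ≡-refl ≡-refl ≡-refl
            (≡.trans (sym (totalSurplus≡ T)) (sym t≡s))
    where
    T = mkTriangle a b c R perm ab ac bc
    open Triangle T using (surplusAt; rest)
    tadpole : (∃ λ S → S ↭ A × TadpoleList S) → ∃ λ S → S ↭ A × (CycleList S ⊎ TadpoleList S)
    tadpole (S , p , tad) = S , p , inj₂ tad
    -- The total surplus is 1, so exactly one of the four parts is 1. It cannot lie off the
    -- triangle, as the triangle would then be closed; the triangle vertex that carries it is where
    -- the tail starts.
    cases : ∀ x y z w → surplusAt a ≡ x → surplusAt b ≡ y → surplusAt c ≡ z → rest ≡ w →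
            x + (y + (z + w)) ≡ 1 → ∃ λ S → S ↭ A × (CycleList S ⊎ TadpoleList S)
    cases 0 0 0 w a≡ b≡ c≡ w≡ _ = ⊥-elim (≢3 (closed-triangle cA T a≡ b≡ c≡))
    cases 1 0 0 0 a≡ b≡ c≡ w≡ _ = tadpole (triangle-listing cA T (≤-reflexive a≡) b≡ c≡ w≡)
    cases 0 1 0 0 a≡ b≡ c≡ w≡ _ =
      tadpole (triangle-listing cA (rotate-triangle T) (≤-reflexive b≡) c≡ a≡ w≡)
    cases 0 0 1 0 a≡ b≡ c≡ w≡ _ =
      tadpole (triangle-listing cA (rotate-triangle (rotate-triangle T)) (≤-reflexive c≡) a≡ b≡ w≡)

-- From the components to the whole graph

module Global {V : Set} (adj : V → V → Bool)
         (adj-sym : ∀ u v → adj u v ≡ adj v u) (adj-irr : ∀ v → adj v v ≡ false) where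
  open Independence adj adj-sym adj-irr
  open Structure adj adj-sym adj-irr
  open Listing adj adj-sym adj-irr

  module _ (h : List V → ℕ) (h-[] : h [] ≡ 0)
           (h-++ : ∀ A B → NoEdges A B → h (A ++ B) ≡ h A + h B) where

    concat-sum : ∀ {As} → Separated As → h (concat As) ≡ sumOver h As
    concat-sum []                      = h-[]
    concat-sum (_∷_ {A} {As} sep seps) =
      ≡.trans (h-++ A (concat As) sep) (cong (λ s → h A + s) (concat-sum seps))

  module _ {p} (p-prime : Prime p) (p≥5 : 5 ≤ p) where
    open PrimePowers p-prime
    open ConvolutionModPrime p-prime

    TrivialMod : List V → Set
    TrivialMod L = ∀ j → p ∣ indPoly every L (suc j)

    concat-trivial : ∀ {As} → Separated As → TrivialMod (concat As) → ∀ {A} → A ∈ As → TrivialMod A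
    concat-trivial (_∷_ {A} {As} sep seps) triv A∈ = go A∈
      where
      degree : ∀ L → DivisibleAbove (length L) (indPoly every L)
      degree L i l<i = subst (p ∣_) (sym (indPoly-degree every L i l<i)) (p ∣0)
      factors = conv≡1⇒factors≡1 (length A) (length (concat As)) (indPoly every A) (indPoly every (concat As))
        (indPoly-0 every A) (indPoly-0 every (concat As)) (degree A) (degree (concat As))
        (λ j → subst (p ∣_) (indPoly-++ every A (concat As) sep (suc j)) (triv j))
      go : ∀ {B} → B ∈ A ∷ As → TrivialMod B
      go (here ≡-refl) j = proj₁ factors (suc j) (s≤s z≤n)
      go (there B∈)      = concat-trivial seps (λ j → proj₂ factors (suc j) (s≤s z≤n)) B∈

    module _ (A : List V) (triv : TrivialMod A) where

      p∣length : p ∣ length A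
      p∣length = subst (p ∣_) (≡.trans (indPoly-1 every A) (count-all A)) (triv 0)

      -- The second coefficient is C(n,2) - E with n the length of `A`, and p divides C(n,2) because
      -- it divides n and is odd.
      p∣edges : p ∣ edges every A
      p∣edges = ∣m+n∣m⇒∣n (subst (p ∣_) (sym choose₂≡) p∣choose₂) (triv 1)
        where
        choose₂≡ : indPoly every A 2 + edges every A ≡ choose₂ (length A)
        choose₂≡ = ≡.trans (indPoly-2 every A) (cong choose₂ (count-all A))
        p∣2choose₂ : p ∣ 2 * choose₂ (length A)
        p∣2choose₂ = ∣m+n∣m⇒∣n (subst (p ∣_) (≡.trans (sym (2*choose₂ (length A))) (+-comm _ (length A)))
                                              (∣m⇒∣m*n (length A) p∣length)) p∣length
        p∣choose₂ : p ∣ choose₂ (length A)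
        p∣choose₂ with euclidsLemma 2 (choose₂ (length A)) p-prime p∣2choose₂
        ... | inj₁ p∣2 = ⊥-elim (<-irrefl ≡-refl (≤-trans (≤-trans (s≤s (s≤s (s≤s z≤n))) p≥5) (∣⇒≤ p∣2)))
        ... | inj₂ d   = d

      length≢3 : length A ≢ 3
      length≢3 eq = <-irrefl ≡-refl
        (≤-trans (≤-trans (s≤s (s≤s (s≤s (s≤s z≤n)))) p≥5) (∣⇒≤ (subst (p ∣_) eq p∣length)))

      not-tree : ¬ (suc (edges every A) ≡ length A)
      not-tree eq = ∤1 (∣m+n∣m⇒∣n (subst (p ∣_) (sym (≡.trans (+-comm _ 1) eq)) p∣length) p∣edges)

    trivial-edges : ∀ {A} → Connected A → TrivialMod A → length A ≤ edges every A
    trivial-edges {A} cA triv with connected-edges cA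
    ... | inj₁ (tree , _)     = ⊥-elim (not-tree A triv tree)
    ... | inj₂ (inj₁ (e , _)) = ≤-reflexive (sym e)
    ... | inj₂ (inj₂ lt)      = <⇒≤ lt

    edges≡length⇒unicyclic : ∀ {A} → Connected A → TrivialMod A → length A ≡ edges every A → Unicyclic A
    edges≡length⇒unicyclic {A} cA triv eq with connected-edges cA
    ... | inj₁ (tree , _) = ⊥-elim (not-tree A triv tree)
    ... | inj₂ (inj₁ u)   = u
    ... | inj₂ (inj₂ lt)  = ⊥-elim (<-irrefl eq lt)

    -- Tightness is used twice. No component has fewer edges than vertices and the totals agree, so
    -- all are unicyclic; then no component has more triangles than surplus and the totals agree
    -- again.
    listed-components : ∀ {As} → Separated As → (∀ {A} → A ∈ As → Connected A) →
      TrivialMod (concat As) → edges every (concat As) ≡ length (concat As) →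
      triangles every (concat As) ≡ totalSurplus (concat As) →
      ∀ {A} → A ∈ As → ∃ λ S → S ↭ A × (CycleList S ⊎ TadpoleList S)
    listed-components {As} seps conn triv e≡ t≡ {A} A∈ =
      listing (conn A∈) (unicyclic A∈) (length≢3 A (trivial A∈)) (surplus≡ A∈)
      where
      trivial : ∀ {A} → A ∈ As → TrivialMod A
      trivial = concat-trivial seps triv
      edges≡ : ∀ {A} → A ∈ As → length A ≡ edges every A
      edges≡ = sumOver-tight length (edges every) As (λ {A} A∈ → trivial-edges {A} (conn A∈) (trivial A∈))
        (≡.trans (sym (concat-sum length ≡-refl (λ A B _ → length-++ A) seps))
          (≡.trans (sym e≡) (concat-sum (edges every) ≡-refl (edges-++ every) seps)))
      unicyclic : ∀ {A} → A ∈ As → Unicyclic A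
      unicyclic {A} A∈ = edges≡length⇒unicyclic {A} (conn A∈) (trivial A∈) (edges≡ A∈)
      surplus≡ : ∀ {A} → A ∈ As → triangles every A ≡ totalSurplus A
      surplus≡ = sumOver-tight (triangles every) totalSurplus As
        (λ {A} A∈ → triangles≤totalSurplus {A} (conn A∈) (unicyclic A∈) (length≢3 A (trivial A∈)))
        (≡.trans (sym (concat-sum (triangles every) ≡-refl (triangles-++ every) seps))
          (≡.trans t≡ (concat-sum totalSurplus ≡-refl totalSurplus-++ seps)))

  cycle-length : ∀ {L} → CycleList L → 3 ≤ length L
  cycle-length (close {x} {h} {z} M _ _ _ _) =
    s≤s (s≤s (subst (1 ≤_) (sym (≡.trans (length-++ M) (+-comm (length M) 1))) (s≤s z≤n)))

  indPoly-listed : ∀ {S} → CycleList S ⊎ TadpoleList S → ∀ j → indPoly every S j ≡ cyclePoly (length S) j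
  indPoly-listed (inj₁ cyc) = indPoly-cycle cyc
  indPoly-listed (inj₂ tad) = indPoly-tadpole tad

  listed-length : ∀ {S} → CycleList S ⊎ TadpoleList S → 3 ≤ length S
  listed-length (inj₁ cyc) = cycle-length cyc
  listed-length (inj₂ tad) = tadpole-length tad

  eval-cyclePoly′ : ∀ {n} → 3 ≤ n → eval n (cyclePoly n) ≡ pos (2 ^ suc n)
  eval-cyclePoly′ (s≤s (s≤s (s≤s {n = m} _))) = eval-cyclePoly m

  evalOn-listed : ∀ {A S} → S ↭ A → CycleList S ⊎ TadpoleList S → evalOn every A ≡ pos (2 ^ suc (length A))
  evalOn-listed {A} {S} p s = begin
    evalOn every A                      ≡⟨ sym (evalOn-↭ every p) ⟩
    eval (length S) (indPoly every S)   ≡⟨ eval-cong (length S) (indPoly-listed s) ⟩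
    eval (length S) (cyclePoly (length S)) ≡⟨ eval-cyclePoly′ (listed-length s) ⟩
    pos (2 ^ suc (length S))            ≡⟨ cong (λ l → pos (2 ^ suc l)) (↭-length p) ⟩
    pos (2 ^ suc (length A))            ∎
    where open ≡-Reasoning

  -- Each component adds 1 to the exponent beyond its number of vertices, so the exponent reveals
  -- the number of components.
  evalOn-concat : ∀ {As} → Separated As → (∀ {A} → A ∈ As → evalOn every A ≡ pos (2 ^ suc (length A))) →
                  evalOn every (concat As) ≡ pos (2 ^ (length As + length (concat As)))
  evalOn-concat []                      h = ≡-refl
  evalOn-concat (_∷_ {A} {As} sep seps) h = begin
    evalOn every (A ++ concat As)
      ≡⟨ evalOn-++ every A (concat As) sep ⟩
    evalOn every A ℤ.* evalOn every (concat As)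
      ≡⟨ cong₂ ℤ._*_ (h (here ≡-refl)) (evalOn-concat seps (h ∘ there)) ⟩
    pos (2 ^ suc (length A)) ℤ.* pos (2 ^ (length As + length (concat As)))
      ≡⟨ sym (ℤ.pos-* (2 ^ suc (length A)) (2 ^ (length As + length (concat As)))) ⟩
    pos (2 ^ suc (length A) * 2 ^ (length As + length (concat As)))
      ≡⟨ cong pos (sym (^-distribˡ-+-* 2 (suc (length A)) (length As + length (concat As)))) ⟩
    pos (2 ^ (suc (length A) + (length As + length (concat As))))
      ≡⟨ cong (λ i → pos (2 ^ i)) (≡.trans (tidy (length A) (length As) (length (concat As)))
           (cong (λ l → suc (length As) + l) (sym (length-++ A)))) ⟩
    pos (2 ^ (suc (length As) + length (A ++ concat As))) ∎
    where
    open ≡-Reasoning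
    tidy : ∀ a b c → suc a + (b + c) ≡ suc b + (a + c)
    tidy = solve-∀

  module _ (L : List V) (m : ℕ) (same : ∀ j → indPoly every L j ≡ cyclePoly (4 + m) j) where

    same⇒length : length L ≡ 4 + m
    same⇒length = begin
      length L                                 ≡⟨ sym (≡.trans (indPoly-1 every L) (count-all L)) ⟩
      indPoly every L 1                        ≡⟨ same 1 ⟩
      pathPoly (3 + m) 1 + pathPoly (1 + m) 0  ≡⟨ cong₂ _+_ (pathPoly-1 (3 + m)) (pathPoly-0 (1 + m)) ⟩
      3 + m + 1                                ≡⟨ +-comm (3 + m) 1 ⟩
      4 + m                                    ∎
      where open ≡-Reasoning

    same⇒edges : edges every L ≡ 4 + m
    -- The cancelled constant is the second coefficient of C_n for n = 4 + m.
    same⇒edges = +-cancelˡ-≡ (choose₂ (2 + m) + (1 + m)) _ _ (begin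
      choose₂ (2 + m) + (1 + m) + edges every L
        ≡⟨ cong (_+ edges every L) (sym (≡.trans (same 2) (cong₂ _+_ (pathPoly-2 (2 + m)) (pathPoly-1 (1 + m))))) ⟩
      indPoly every L 2 + edges every L
        ≡⟨ indPoly-2 every L ⟩
      choose₂ (count every L)
        ≡⟨ cong choose₂ (≡.trans (count-all L) same⇒length) ⟩
      choose₂ (2 + m) + (2 + m) + (3 + m)
        ≡⟨ tidy (choose₂ (2 + m)) m ⟩
      choose₂ (2 + m) + (1 + m) + (4 + m) ∎)
      where
      open ≡-Reasoning
      tidy : ∀ c m → c + (2 + m) + (3 + m) ≡ c + (1 + m) + (4 + m)
      tidy = solve-∀

    same⇒surplus : triangles every L ≡ totalSurplus L
    -- The cancelled constant is i_3 + n^2 for C_n with n = 4 + m, where `m * m` is written as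
    -- `2 * c + m`; n^2 is the product of edges and vertices in `indPoly-3`.
    same⇒surplus = +-cancelˡ-≡ (choose₃ (1 + m) + (3 * c + 9 * m + 16)) _ _ (begin
      choose₃ (1 + m) + (3 * c + 9 * m + 16) + T
        ≡⟨ step₁ (choose₃ (1 + m)) c m T ⟩
      choose₃ (1 + m) + c + (T + ((2 * c + m) + (8 * m + 16)))
        ≡⟨ cong (λ s → choose₃ (1 + m) + c + (T + (s + (8 * m + 16)))) (2*choose₂ m) ⟩
      choose₃ (1 + m) + c + (T + (m * m + (8 * m + 16)))
        ≡⟨ step₂ (choose₃ (1 + m)) c m T ⟩
      choose₃ (1 + m) + c + (T + (4 + m) * (4 + m))
        ≡⟨ cong₂ (λ q e → q + (T + e)) (sym (≡.trans (same 3) (cong₂ _+_ (pathPoly-3 (1 + m)) (pathPoly-2 m))))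
             (sym (cong₂ _*_ same⇒edges same⇒length)) ⟩
      indPoly every L 3 + (T + edges every L * length L)
        ≡⟨ indPoly-3 L ⟩
      choose₃ (length L) + (S + 2 * edges every L)
        ≡⟨ cong₂ (λ l e → choose₃ l + (S + 2 * e)) same⇒length same⇒edges ⟩
      choose₃ (4 + m) + (S + 2 * (4 + m))
        ≡⟨ cong (λ s → choose₃ (4 + m) + (s + 2 * (4 + m))) S≡ ⟩
      choose₃ (4 + m) + (4 + m + G + 2 * (4 + m))
        ≡⟨ step₃ (choose₃ (1 + m)) c m G ⟩
      choose₃ (1 + m) + (3 * c + 9 * m + 16) + G ∎)
      where
      open ≡-Reasoning
      c = choose₂ m
      T = triangles every L
      G = totalSurplus L
      S = sumOver (choose₂ ∘ degreeIn L) L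
      S≡ : S ≡ 4 + m + G
      S≡ = +-cancelʳ-≡ (4 + m) S (4 + m + G) (≡.trans
        (≡.trans (cong (λ l → S + l) (sym same⇒length)) (≡.trans (sum-choose₂ L) (cong (λ e → 2 * e + G) same⇒edges)))
        (tidy m G))
        where
        tidy : ∀ m G → 2 * (4 + m) + G ≡ 4 + m + G + (4 + m)
        tidy = solve-∀
      step₁ : ∀ x c m T → x + (3 * c + 9 * m + 16) + T ≡ x + c + (T + ((2 * c + m) + (8 * m + 16)))
      step₁ = solve-∀
      step₂ : ∀ x c m T → x + c + (T + (m * m + (8 * m + 16))) ≡ x + c + (T + (4 + m) * (4 + m))
      step₂ = solve-∀
      step₃ : ∀ x c m G → x + (c + m) + (c + m + (1 + m)) + (c + m + (1 + m) + (2 + m)) + (4 + m + G + 2 * (4 + m))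
            ≡ x + (3 * c + 9 * m + 16) + G
      step₃ = solve-∀

  single-component : ∀ {As} {L : List V} → concat As ↭ L → length As ≡ 1 → ∃ λ A → A ∈ As × A ↭ L
  single-component {A ∷ []} p _ = A , here ≡-refl , subst (_↭ _) (++-identityʳ A) p

  same⇒listed : ∀ {p} → Prime p → 5 ≤ p → ∀ {m} L → (∀ j → p ∣ cyclePoly (4 + m) (suc j)) →
    (∀ j → indPoly every L j ≡ cyclePoly (4 + m) j) → ∃ λ S → S ↭ L × (CycleList S ⊎ TadpoleList S)
  same⇒listed p-prime p≥5 {m} L p∣ same with components (length L) L ≤-refl
  ... | As , conn , seps , perm =
    let A , A∈ , A↭L = single-component perm one
        S , S↭A , s  = listed A∈
    in S , ↭-trans S↭A A↭L , s
    where
    same′ : ∀ j → indPoly every (concat As) j ≡ cyclePoly (4 + m) j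
    same′ j = ≡.trans (indPoly-↭ perm every j) (same j)
    len : length (concat As) ≡ 4 + m
    len = same⇒length (concat As) m same′
    listed : ∀ {A} → A ∈ As → ∃ λ S → S ↭ A × (CycleList S ⊎ TadpoleList S)
    listed = listed-components p-prime p≥5 seps (λ A∈ → All.lookup conn A∈)
      (λ j → subst (_ ∣_) (sym (same′ (suc j))) (p∣ j))
      (≡.trans (same⇒edges (concat As) m same′) (sym len)) (same⇒surplus (concat As) m same′)
    value : evalOn every (concat As) ≡ pos (2 ^ (1 + (4 + m)))
    value = ≡.trans (cong (λ l → eval l (indPoly every (concat As))) len)
      (≡.trans (eval-cong (4 + m) same′) (eval-cyclePoly (1 + m)))
    one : length As ≡ 1
    -- The value at -1/4 is compared in two forms: by components, and as that of one cycle on all n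
    -- vertices.
    one = +-cancelʳ-≡ (length (concat As)) _ _ (2^-injective (ℤ.+-injective (≡.trans
      (sym (evalOn-concat seps (λ A∈ → let S , p , s = listed A∈ in evalOn-listed p s)))
      (≡.trans value (cong (λ l → pos (2 ^ suc l)) (sym len))))))

-- Lists without repetitions, and transport along maps of graphs

Unique-↭ : ∀ {A : Set} {xs ys : List A} → xs ↭ ys → Unique xs → Unique ys
Unique-↭ {A} p = Permₛ.Unique-resp-↭ (setoid A) (↭⇒↭ₛ p)

unique-↭ : ∀ {A : Set} {xs ys : List A} → Unique xs → Unique ys →
           (∀ {x} → x ∈ xs → x ∈ ys) → (∀ {x} → x ∈ ys → x ∈ xs) → xs ↭ ys
unique-↭ {xs = []} {[]}     _ _ _ _  = refl
unique-↭ {xs = []} {y ∷ ys} _ _ _ ⊇  = case ⊇ (here ≡-refl) of λ ()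
unique-↭ {A} {xs = x ∷ xs} {ys} (x∉xs ∷ uxs) uys ⊆ ⊇ with extract (⊆ (here ≡-refl))
... | ys′ , p with Unique-↭ p uys
...   | x∉ys′ ∷ uys′ = ↭-trans (prep x (unique-↭ uxs uys′ ⊆′ ⊇′)) (↭-sym p)
  where
  ⊆′ : ∀ {y} → y ∈ xs → y ∈ ys′
  ⊆′ y∈xs with ∈-resp-↭ p (⊆ (there y∈xs))
  ... | here ≡-refl = ⊥-elim (All.lookup x∉xs y∈xs ≡-refl)
  ... | there y∈    = y∈
  ⊇′ : ∀ {y} → y ∈ ys′ → y ∈ xs
  ⊇′ y∈ys′ with ⊇ (∈-resp-↭ (↭-sym p) (there y∈ys′))
  ... | here ≡-refl = ⊥-elim (All.lookup x∉ys′ y∈ys′ ≡-refl)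
  ... | there y∈    = y∈

bijection-↭ : ∀ {m n} (f : Fin m → Fin n) → Bijective _≡_ _≡_ f → map f (allFin m) ↭ allFin n
bijection-↭ {m} {n} f (inj , surj) = unique-↭ (Uniqueₚ.map⁺ inj (Uniqueₚ.allFin⁺ m)) (Uniqueₚ.allFin⁺ n)
  (λ {x} _ → ∈-allFin x)
  (λ {y} _ → let x , fx = surj y in subst (_∈ map f (allFin m)) (fx ≡-refl) (∈-map⁺ f (∈-allFin x)))

map-toℕ-↭ : ∀ n → map toℕ (allFin n) ↭ downFrom n
map-toℕ-↭ n = unique-↭ (Uniqueₚ.map⁺ toℕ-injective (Uniqueₚ.allFin⁺ n)) (Uniqueₚ.downFrom⁺ n)
  (λ x∈ → let i , _ , eq = ∈-map⁻ toℕ x∈ in subst (_∈ downFrom n) (sym eq) (∈-downFrom⁺ (toℕ<n i)))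
  (λ x∈ → let lt = ∈-downFrom⁻ x∈ in
          subst (_∈ map toℕ (allFin n)) (toℕ-fromℕ< lt) (∈-map⁺ toℕ (∈-allFin (fromℕ< lt))))

module _ {V W : Set} (adj : V → V → Bool) (adj-sym : ∀ u v → adj u v ≡ adj v u) (adj-irr : ∀ v → adj v v ≡ false)
         (adj′ : W → W → Bool) (adj′-sym : ∀ u v → adj′ u v ≡ adj′ v u) (adj′-irr : ∀ v → adj′ v v ≡ false) where
  open Independence adj adj-sym adj-irr
  module I′ = Independence adj′ adj′-sym adj′-irr

  indPoly-map : (φ : V → W) → (∀ u v → adj u v ≡ adj′ (φ u) (φ v)) →
                ∀ f f′ → (∀ v → f v ≡ f′ (φ v)) → ∀ L j → indPoly f L j ≡ I′.indPoly f′ (map φ L) j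
  indPoly-map φ hom f f′ eq L       zero    = ≡.trans (indPoly-0 f L) (sym (I′.indPoly-0 f′ (map φ L)))
  indPoly-map φ hom f f′ eq []      (suc j) = ≡-refl
  indPoly-map φ hom f f′ eq (v ∷ L) (suc j) rewrite eq v =
    cong₂ (λ a b → a + (if f′ (φ v) then b else 0)) (indPoly-map φ hom f f′ eq L (suc j))
      (indPoly-map φ hom (f ∖N v) (f′ I′.∖N φ v) (λ u → cong₂ (λ a b → a ∧ not b) (eq u) (hom v u)) L j)

-- Independent sets as bit vectors

length-filter : ∀ {A : Set} (P : A → Bool) xs → length (filter (λ x → P x Bool.≟ true) xs) ≡ count P xs
length-filter P []       = ≡-refl
length-filter P (x ∷ xs) with P x
... | true  = cong suc (length-filter P xs)
... | false = length-filter P xs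

count-map : ∀ {A B : Set} (P : B → Bool) (g : A → B) xs → count P (map g xs) ≡ count (P ∘ g) xs
count-map P g []       = ≡-refl
count-map P g (x ∷ xs) = cong (λ s → bit (P (g x)) + s) (count-map P g xs)

module BitVectors {V : Set} (adj : V → V → Bool)
         (adj-sym : ∀ u v → adj u v ≡ adj v u) (adj-irr : ∀ v → adj v v ≡ false) where
  open Independence adj adj-sym adj-irr

  -- Bits are read from the front, and each chosen vertex forbids its neighbours, exactly as in
  -- `indPoly`. This is the bridge to `isIndependent`, which tests all pairs.
  independentIn : ∀ {n} → (V → Bool) → (Fin n → V) → Vec Bool n → Bool
  independentIn f φ []          = true
  independentIn f φ (true ∷ S)  = f (φ zero) ∧ independentIn (f ∖N φ zero) (φ ∘ suc) S
  independentIn f φ (false ∷ S) = independentIn f (φ ∘ suc) S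

  count-independent : ∀ n f (φ : Fin n → V) j →
    count (λ S → independentIn f φ S ∧ (size S ≡ᵇ j)) (subsets n) ≡ indPoly f (tabulate φ) j
  count-independent zero    f φ zero    = ≡-refl
  count-independent zero    f φ (suc j) = ≡-refl
  count-independent (suc n) f φ j = begin
    count Good (map (true ∷_) (subsets n) ++ map (false ∷_) (subsets n))
      ≡⟨ sumOver-++ _ (map (true ∷_) (subsets n)) _ ⟩
    count Good (map (true ∷_) (subsets n)) + count Good (map (false ∷_) (subsets n))
      ≡⟨ cong₂ _+_ (count-map Good (true ∷_) (subsets n)) (count-map Good (false ∷_) (subsets n)) ⟩
    count (Good ∘ (true ∷_)) (subsets n) + count (Good ∘ (false ∷_)) (subsets n)
      ≡⟨ cong (λ s → count (Good ∘ (true ∷_)) (subsets n) + s) (count-independent n f (φ ∘ suc) j) ⟩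
    count (Good ∘ (true ∷_)) (subsets n) + indPoly f (tabulate (φ ∘ suc)) j
      ≡⟨ with-first j ⟩
    indPoly f (tabulate φ) j ∎
    where
    open ≡-Reasoning
    Good : Vec Bool (suc n) → Bool
    Good S = independentIn f φ S ∧ (size S ≡ᵇ j)
    with-first : ∀ j → count (λ S → (f (φ zero) ∧ independentIn (f ∖N φ zero) (φ ∘ suc) S) ∧ (suc (size S) ≡ᵇ j))
                         (subsets n) + indPoly f (tabulate (φ ∘ suc)) j ≡ indPoly f (tabulate φ) j
    with-first zero = cong₂ _+_ (false⇒count≡0 _ (subsets n) (λ _ → ∧-zeroʳ _)) (indPoly-0 f (tabulate (φ ∘ suc)))
    with-first (suc j) with f (φ zero)
    ... | true  = ≡.trans (cong (_+ indPoly f (tabulate (φ ∘ suc)) (suc j))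
                    (count-independent n (f ∖N φ zero) (φ ∘ suc) j)) (+-comm (indPoly (f ∖N φ zero) (tabulate (φ ∘ suc)) j) _)
    ... | false = ≡.trans (cong (_+ indPoly f (tabulate (φ ∘ suc)) (suc j))
                    (false⇒count≡0 _ (subsets n) (λ _ → ≡-refl))) (sym (+-identityʳ _))

  Independent : ∀ {n} → (V → Bool) → (Fin n → V) → Vec Bool n → Set
  Independent f φ S = (∀ i → lookup S i ≡ true → f (φ i) ≡ true) ×
                      (∀ i j → lookup S i ≡ true → lookup S j ≡ true → adj (φ i) (φ j) ≡ false)

  ∧-true : ∀ {a b} → a ∧ b ≡ true → a ≡ true × b ≡ true
  ∧-true {true} h = ≡-refl , h

  not-true : ∀ {a} → not a ≡ true → a ≡ false
  not-true {false} _ = ≡-refl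

  independentIn⇒ : ∀ {n} f (φ : Fin n → V) S → independentIn f φ S ≡ true → Independent f φ S
  independentIn⇒ f φ []          h = (λ ()) , (λ ())
  independentIn⇒ f φ (false ∷ S) h with independentIn⇒ f (φ ∘ suc) S h
  ... | inside , indep = (λ { (suc i) → inside i }) , (λ { (suc i) (suc j) → indep i j })
  independentIn⇒ {suc n} f φ (true ∷ S) h with ∧-true {f (φ zero)} h
  ... | f₀ , h′ with independentIn⇒ (f ∖N φ zero) (φ ∘ suc) S h′
  ...   | inside , indep = inside′ , indep′
    where
    away : ∀ i → lookup S i ≡ true → adj (φ zero) (φ (suc i)) ≡ false
    away i Si = not-true (proj₂ (∧-true {f (φ (suc i))} (inside i Si)))
    inside′ : ∀ i → lookup (true ∷ S) i ≡ true → f (φ i) ≡ true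
    inside′ zero    _  = f₀
    inside′ (suc i) Si = proj₁ (∧-true (inside i Si))
    indep′ : ∀ i j → lookup (true ∷ S) i ≡ true → lookup (true ∷ S) j ≡ true → adj (φ i) (φ j) ≡ false
    indep′ zero    zero    _  _  = adj-irr (φ zero)
    indep′ zero    (suc j) _  Sj = away j Sj
    indep′ (suc i) zero    Si _  = ≡.trans (adj-sym _ _) (away i Si)
    indep′ (suc i) (suc j) Si Sj = indep i j Si Sj

  ⇒independentIn : ∀ {n} f (φ : Fin n → V) S → Independent f φ S → independentIn f φ S ≡ true
  ⇒independentIn f φ []          h = ≡-refl
  ⇒independentIn f φ (false ∷ S) (inside , indep) =
    ⇒independentIn f (φ ∘ suc) S ((λ i → inside (suc i)) , (λ i j → indep (suc i) (suc j)))
  ⇒independentIn f φ (true ∷ S)  (inside , indep) = cong₂ _∧_ (inside zero ≡-refl)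
    (⇒independentIn (f ∖N φ zero) (φ ∘ suc) S
      ((λ i Si → cong₂ (λ a b → a ∧ not b) (inside (suc i) Si) (indep zero (suc i) ≡-refl Si))
      , (λ i j → indep (suc i) (suc j))))

all⇒ : ∀ {A : Set} (P : A → Bool) xs → all P xs ≡ true → ∀ {x} → x ∈ xs → P x ≡ true
all⇒ P (x ∷ xs) h (here ≡-refl) with P x
... | true = ≡-refl
all⇒ P (x ∷ xs) h (there x∈xs) with P x
... | true = all⇒ P xs h x∈xs

⇒all : ∀ {A : Set} (P : A → Bool) xs → (∀ x → P x ≡ true) → all P xs ≡ true
⇒all P []       h = ≡-refl
⇒all P (x ∷ xs) h = cong₂ _∧_ (h x) (⇒all P xs h)

module _ {n} (G : Graph n) (simple : IsSimpleGraph G) where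
  open Independence G (proj₁ simple) (proj₂ simple)
  open BitVectors G (proj₁ simple) (proj₂ simple)

  -- `isIndependent` also tests the diagonal and both orders of each pair; irreflexivity and
  -- symmetry account for these.
  isIndependent≡ : ∀ S → isIndependent G S ≡ independentIn every (λ i → i) S
  isIndependent≡ S = ⇔→≡ {z = true} (mk⇔
    (λ h → ⇒independentIn every (λ i → i) S ((λ _ _ → ≡-refl) , λ i j Si Sj →
       pair⇒ Si Sj (all⇒ _ (allFin n) (all⇒ _ (allFin n) h (∈-allFin i)) (∈-allFin j))))
    (λ h → ⇒all _ (allFin n) (λ i → ⇒all _ (allFin n) (λ j →
       ⇒pair (proj₂ (independentIn⇒ every (λ i → i) S h) i j)))))
    where
    pair⇒ : ∀ {a b c} → a ≡ true → b ≡ true → not (a ∧ b ∧ c) ≡ true → c ≡ false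
    pair⇒ ≡-refl ≡-refl h = not-true h
    ⇒pair : ∀ {a b c} → (a ≡ true → b ≡ true → c ≡ false) → not (a ∧ b ∧ c) ≡ true
    ⇒pair {true}  {true}  h = cong not (h ≡-refl ≡-refl)
    ⇒pair {true}  {false} h = ≡-refl
    ⇒pair {false} {_}     h = ≡-refl

  indepCoeff≡indPoly : ∀ j → indepCoeff G j ≡ indPoly every (allFin n) j
  indepCoeff≡indPoly j = ≡.trans (length-filter _ (subsets n)) (≡.trans
    (sumOver-cong (subsets n) (λ {S} _ → cong (λ b → bit (b ∧ (size S ≡ᵇ j))) (isIndependent≡ S)))
    (count-independent n every (λ i → i) j))

≅⇒SameIndPoly : ∀ {m n} {H : Graph m} {G : Graph n} → IsSimpleGraph H → IsSimpleGraph G → H ≅ G → SameIndPoly H G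
≅⇒SameIndPoly {m} {n} {H} {G} sH sG (f , bij , hom) j = begin
  indepCoeff H j                        ≡⟨ indepCoeff≡indPoly H sH j ⟩
  IH.indPoly (λ _ → true) (allFin m) j  ≡⟨ indPoly-map H (proj₁ sH) (proj₂ sH) G (proj₁ sG) (proj₂ sG) f hom
                                             (λ _ → true) (λ _ → true) (λ _ → ≡-refl) (allFin m) j ⟩
  IG.indPoly (λ _ → true) (map f (allFin m)) j ≡⟨ IG.indPoly-↭ (bijection-↭ f bij) (λ _ → true) j ⟩
  IG.indPoly (λ _ → true) (allFin n) j  ≡⟨ sym (indepCoeff≡indPoly G sG j) ⟩
  indepCoeff G j                        ∎
  where
  open ≡-Reasoning
  module IH = Independence H (proj₁ sH) (proj₂ sH)
  module IG = Independence G (proj₁ sG) (proj₂ sG)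

-- The graphs C_n and D_n on all of ℕ

cycleArc tadpoleArc : ℕ → ℕ → ℕ → Bool
cycleArc n a b = (suc a ≡ᵇ b) ∨ ((a ≡ᵇ 0) ∧ (b ≡ᵇ n ∸ 1))
tadpoleArc n a b = (suc a ≡ᵇ b) ∨ ((a ≡ᵇ 0) ∧ (b ≡ᵇ 2))

sym-closure : (ℕ → ℕ → Bool) → ℕ → ℕ → Bool
sym-closure r a b = r a b ∨ r b a

sym-closure-sym : ∀ r a b → sym-closure r a b ≡ sym-closure r b a
sym-closure-sym r a b = ∨-comm (r a b) (r b a)

sym-closure-irr : ∀ {r} → (∀ a → r a a ≡ false) → ∀ a → sym-closure r a a ≡ false
sym-closure-irr h a rewrite h a = ≡-refl

≢⇒≡ᵇ : ∀ {a b} → a ≢ b → (a ≡ᵇ b) ≡ false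
≢⇒≡ᵇ {a} {b} a≢b with a ≡ᵇ b in eq
... | false = ≡-refl
... | true  = ⊥-elim (a≢b (≡ᵇ⇒≡ a b (subst Bool.T (sym eq) _)))

≡ᵇ-refl : ∀ a → (a ≡ᵇ a) ≡ true
≡ᵇ-refl zero    = ≡-refl
≡ᵇ-refl (suc a) = ≡ᵇ-refl a

cycleArc-irr : ∀ n a → cycleArc (2 + n) a a ≡ false
cycleArc-irr n zero    = ≡-refl
cycleArc-irr n (suc a) rewrite ≢⇒≡ᵇ {suc a} {a} (λ ()) = ≡-refl

tadpoleArc-irr : ∀ n a → tadpoleArc n a a ≡ false
tadpoleArc-irr n zero    = ≡-refl
tadpoleArc-irr n (suc a) rewrite ≢⇒≡ᵇ {suc a} {a} (λ ()) = ≡-refl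

cycle-successor : ∀ n l → sym-closure (cycleArc n) (suc l) l ≡ true
cycle-successor n l rewrite ≡ᵇ-refl l = ∨-zeroʳ _

tadpole-successor : ∀ n l → sym-closure (tadpoleArc n) (suc l) l ≡ true
tadpole-successor n l rewrite ≡ᵇ-refl l = ∨-zeroʳ _

-- The labels differ by at least 2, so only the closing arc between 0 and n - 1 could join them, and
-- the second hypothesis rules it out.
cycle-skip : ∀ n {k l} → k < l → (k ≡ᵇ 0) ∧ (suc l ≡ᵇ n ∸ 1) ≡ false →
             sym-closure (cycleArc n) (suc l) k ≡ false
cycle-skip n {k} {l} k<l h
  rewrite ≢⇒≡ᵇ (>⇒≢ (m<n⇒m<1+n (m<n⇒m<1+n k<l))) | ≢⇒≡ᵇ (<⇒≢ k<l) = h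

-- The larger label is at least 3, so the extra edge between 0 and 2 does not occur.
tadpole-skip : ∀ n {k l} → k < l → 2 ≤ l → sym-closure (tadpoleArc n) (suc l) k ≡ false
tadpole-skip n {k} {suc (suc l)} k<l 2≤l
  rewrite ≢⇒≡ᵇ (>⇒≢ (m<n⇒m<1+n (m<n⇒m<1+n k<l))) | ≢⇒≡ᵇ (<⇒≢ k<l) = ∧-zeroʳ _
tadpole-skip n {l = suc zero} _ (s≤s ())

cycle-closing : ∀ n → sym-closure (cycleArc (3 + n)) (2 + n) 0 ≡ true
cycle-closing n = ≡ᵇ-refl n

-- Labels count from the end, because listings of components grow at the head.
label : ∀ {A : Set} {v : A} {L} → v ∈ L → ℕ
label {L = x ∷ L} (here _)  = length L
label {L = x ∷ L} (there p) = label p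

label< : ∀ {A : Set} {v : A} {L} (p : v ∈ L) → label p < length L
label< (here _)  = ≤-refl
label< (there p) = m<n⇒m<1+n (label< p)

label-injective : ∀ {A : Set} {u v : A} {L} (p : u ∈ L) (q : v ∈ L) → label p ≡ label q → u ≡ v
label-injective (here ≡-refl) (here ≡-refl) _  = ≡-refl
label-injective (here _)      (there q)     eq = ⊥-elim (<-irrefl (sym eq) (label< q))
label-injective (there p)     (here _)      eq = ⊥-elim (<-irrefl eq (label< p))
label-injective (there p)     (there q)     eq = label-injective p q eq

label-surjective : ∀ {A : Set} (L : List A) k → k < length L → ∃₂ λ v (p : v ∈ L) → label p ≡ k
label-surjective (x ∷ L) k (s≤s k≤) with m≤n⇒m<n∨m≡n k≤
... | inj₂ ≡-refl = x , here ≡-refl , ≡-refl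
... | inj₁ k<     = let v , p , eq = label-surjective L k k< in v , there p , eq

label-unique : ∀ {A : Set} {v : A} {L} → Unique L → (p q : v ∈ L) → label p ≡ label q
label-unique u           (here _)      (here _)      = ≡-refl
label-unique (x∉ ∷ u)    (here ≡-refl) (there q)     = ⊥-elim (All.lookup x∉ q ≡-refl)
label-unique (x∉ ∷ u)    (there p)     (here ≡-refl) = ⊥-elim (All.lookup x∉ p ≡-refl)
label-unique (x∉ ∷ u)    (there p)     (there q)     = label-unique u p q

label-snoc : ∀ {A : Set} {v z : A} M (p : v ∈ M ++ [ z ]) →
             (v ∈ M × 0 < label p) ⊎ (v ≡ z × label p ≡ 0)
label-snoc []      (here eq) = inj₂ (eq , ≡-refl)
label-snoc (x ∷ M) (here eq) =
  inj₁ (here eq , subst (0 <_) (sym (≡.trans (length-++ M) (+-comm (length M) 1))) (s≤s z≤n))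
label-snoc (x ∷ M) (there p) with label-snoc M p
... | inj₁ (v∈M , 0<) = inj₁ (there v∈M , 0<)
... | inj₂ z          = inj₂ z

module Labelling {V : Set} (adj : V → V → Bool)
         (adj-sym : ∀ u v → adj u v ≡ adj v u) (adj-irr : ∀ v → adj v v ≡ false) where
  open Structure adj adj-sym adj-irr

  -- Each entry is compared with those behind it, whose number `length L` is its own label. This
  -- matches the way listings grow.
  Agrees : (ℕ → ℕ → Bool) → List V → Set
  Agrees R []      = ⊤
  Agrees R (x ∷ L) = (∀ {y} (p : y ∈ L) → adj x y ≡ R (length L) (label p)) × Agrees R L

  agrees : ∀ {R} → (∀ a b → R a b ≡ R b a) → (∀ a → R a a ≡ false) → ∀ {L} → Agrees R L →
           ∀ {u v} (p : u ∈ L) (q : v ∈ L) → adj u v ≡ R (label p) (label q)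
  agrees R-sym R-irr (h , ag) (here ≡-refl) (here ≡-refl) = ≡.trans (adj-irr _) (sym (R-irr _))
  agrees R-sym R-irr (h , ag) (here ≡-refl) (there q)     = h q
  agrees R-sym R-irr (h , ag) (there p)     (here ≡-refl) = ≡.trans (adj-sym _ _) (≡.trans (h p) (R-sym _ _))
  agrees R-sym R-irr (h , ag) (there p)     (there q)     = agrees R-sym R-irr ag p q

  -- The bound keeps all labels below n - 1, so the closing arc joins no two vertices of the path.
  path-agrees : ∀ n {L} → PathList L → length L ≤ n ∸ 1 → Agrees (sym-closure (cycleArc n)) L
  path-agrees n empty      le = tt
  path-agrees n (single x) le = (λ ()) , tt
  path-agrees n (step {x} {y} {L} xy xL path) le = adjacent , path-agrees n path (≤-trans (n≤1+n _) le)
    where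
    adjacent : ∀ {v} (p : v ∈ y ∷ L) → adj x v ≡ sym-closure (cycleArc n) (suc (length L)) (label p)
    adjacent (here ≡-refl) = ≡.trans xy (sym (cycle-successor n (length L)))
    adjacent (there p)     = ≡.trans (xL p) (sym (cycle-skip n (label< p)
      (≡.trans (cong ((label p ≡ᵇ 0) ∧_) (≢⇒≡ᵇ (<⇒≢ le))) (∧-zeroʳ _))))

  cycle-agrees : ∀ {L} → CycleList L → Agrees (sym-closure (cycleArc (length L))) L
  cycle-agrees (close {x} {h} {z} M path xh xz xM) = adjacent , path-agrees n path ≤-refl
    where
    n = length (x ∷ h ∷ M ++ [ z ])
    len : length (M ++ [ z ]) ≡ suc (length M)
    len = ≡.trans (length-++ M) (+-comm (length M) 1)
    closing : sym-closure (cycleArc n) (suc (length (M ++ [ z ]))) 0 ≡ true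
    closing = subst (λ l → sym-closure (cycleArc (2 + l)) (suc l) 0 ≡ true) (sym len) (cycle-closing (length M))
    adjacent : ∀ {v} (p : v ∈ h ∷ M ++ [ z ]) →
               adj x v ≡ sym-closure (cycleArc n) (suc (length (M ++ [ z ]))) (label p)
    adjacent (here ≡-refl) = ≡.trans xh (sym (cycle-successor n (length (M ++ [ z ]))))
    adjacent (there p) with label-snoc M p
    ... | inj₁ (v∈M , 0<)      = ≡.trans (xM v∈M) (sym (cycle-skip n (label< p)
                                   (cong (_∧ (suc (length (M ++ [ z ])) ≡ᵇ n ∸ 1)) (≢⇒≡ᵇ (>⇒≢ 0<)))))
    ... | inj₂ (≡-refl , eq)   = ≡.trans xz (sym (≡.trans
                                   (cong (sym-closure (cycleArc n) (suc (length (M ++ [ z ])))) eq) closing))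

  tadpole-agrees : ∀ n {L} → TadpoleList L → Agrees (sym-closure (tadpoleArc n)) L
  tadpole-agrees n (triangle cb ca ba) =
    (λ { (here ≡-refl) → cb ; (there (here ≡-refl)) → ca }) , (λ { (here ≡-refl) → ba }) , (λ ()) , tt
  tadpole-agrees n (step {x} {y} {L} xy xL tad) = adjacent , tadpole-agrees n tad
    where
    adjacent : ∀ {v} (p : v ∈ y ∷ L) → adj x v ≡ sym-closure (tadpoleArc n) (suc (length L)) (label p)
    adjacent (here ≡-refl) = ≡.trans xy (sym (tadpole-successor n (length L)))
    adjacent (there p)     = ≡.trans (xL p) (sym (tadpole-skip n (label< p) (s≤s⁻¹ (tadpole-length tad))))

-- From a listing to an isomorphism

module _ {m} (H : Graph m) (simple : IsSimpleGraph H) where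
  open Labelling H (proj₁ simple) (proj₂ simple)

  agrees⇒≅ : ∀ {n} {R : ℕ → ℕ → Bool} {G : Graph n} →
             (∀ a b → R a b ≡ R b a) → (∀ a → R a a ≡ false) → (∀ i j → G i j ≡ R (toℕ i) (toℕ j)) →
             ∀ {S} → S ↭ allFin m → length S ≡ n → Agrees R S → H ≅ G
  agrees⇒≅ {n} {R} {G} R-sym R-irr G≡R {S} perm ≡-refl ag = f , (injective , surjective) , hom
    where
    mem : ∀ v → v ∈ S
    mem v = ∈-resp-↭ (↭-sym perm) (∈-allFin v)
    unique : Unique S
    unique = Unique-↭ (↭-sym perm) (Uniqueₚ.allFin⁺ m)
    f : Fin m → Fin n
    f v = fromℕ< (label< (mem v))
    toℕ-f : ∀ v → toℕ (f v) ≡ label (mem v)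
    toℕ-f v = toℕ-fromℕ< (label< (mem v))
    injective : ∀ {u v} → f u ≡ f v → u ≡ v
    injective {u} {v} eq = label-injective (mem u) (mem v)
      (≡.trans (sym (toℕ-f u)) (≡.trans (cong toℕ eq) (toℕ-f v)))
    surjective : ∀ k → ∃ λ v → ∀ {u} → u ≡ v → f u ≡ k
    surjective k with label-surjective S (toℕ k) (toℕ<n k)
    -- `f` uses the membership proof `mem v`, which may differ from `p`; without repetitions their
    -- labels coincide.
    ... | v , p , eq = v , λ { ≡-refl → toℕ-injective
            (≡.trans (toℕ-f v) (≡.trans (label-unique unique (mem v) p) eq)) }
    hom : ∀ u v → H u v ≡ G (f u) (f v)
    hom u v = ≡.trans (agrees R-sym R-irr ag (mem u) (mem v))
      (≡.trans (sym (cong₂ R (toℕ-f u) (toℕ-f v))) (sym (G≡R (f u) (f v))))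

-- The polynomials of C_n and D_n from their descending listings

module _ (n : ℕ) where

  C-simple : IsSimpleGraph (C (3 + n))
  C-simple = (λ i j → sym-closure-sym (cycleArc (3 + n)) (toℕ i) (toℕ j))
           , (λ i → sym-closure-irr {cycleArc (3 + n)} (cycleArc-irr (1 + n)) (toℕ i))

  D-simple : IsSimpleGraph (D (3 + n))
  D-simple = (λ i j → sym-closure-sym (tadpoleArc (3 + n)) (toℕ i) (toℕ j))
           , (λ i → sym-closure-irr {tadpoleArc (3 + n)} (tadpoleArc-irr (3 + n)) (toℕ i))

  module CycleOnℕ = Structure (sym-closure (cycleArc (3 + n))) (sym-closure-sym (cycleArc (3 + n)))
                      (sym-closure-irr {cycleArc (3 + n)} (cycleArc-irr (1 + n)))
  module TadpoleOnℕ = Structure (sym-closure (tadpoleArc (3 + n))) (sym-closure-sym (tadpoleArc (3 + n)))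
                        (sym-closure-irr {tadpoleArc (3 + n)} (tadpoleArc-irr (3 + n)))

  downFrom-path : ∀ l → l ≤ 2 + n → CycleOnℕ.PathList (downFrom l)
  downFrom-path zero          _  = CycleOnℕ.empty
  downFrom-path (suc zero)    _  = CycleOnℕ.single 0
  downFrom-path (suc (suc l)) le = CycleOnℕ.step (cycle-successor (3 + n) l)
    (λ {z} z∈ → cycle-skip (3 + n) (∈-downFrom⁻ z∈)
      (≡.trans (cong ((z ≡ᵇ 0) ∧_) (≢⇒≡ᵇ (<⇒≢ le))) (∧-zeroʳ _)))
    (downFrom-path (suc l) (≤-trans (n≤1+n _) le))

  downFrom-cycle : CycleOnℕ.CycleList (downFrom (3 + n))
  -- The last entry 0 is split off to serve as the far end `z` of the path that the head closes.
  downFrom-cycle = subst (λ L → CycleOnℕ.CycleList (2 + n ∷ 1 + n ∷ L)) (downFrom-∷ʳ n)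
    (CycleOnℕ.close (applyDownFrom suc n)
      (subst (λ L → CycleOnℕ.PathList (1 + n ∷ L)) (sym (downFrom-∷ʳ n)) (downFrom-path (2 + n) ≤-refl))
      (cycle-successor (3 + n) (1 + n)) (cycle-closing n) skip)
    where
    skip : ∀ {u} → u ∈ applyDownFrom suc n → sym-closure (cycleArc (3 + n)) (2 + n) u ≡ false
    skip u∈ with ∈-applyDownFrom⁻ suc u∈
    ... | i , i<n , ≡-refl = cycle-skip (3 + n) (s≤s i<n) ≡-refl

  downFrom-tadpole : ∀ l → TadpoleOnℕ.TadpoleList (downFrom (3 + l))
  downFrom-tadpole zero    = TadpoleOnℕ.triangle ≡-refl ≡-refl ≡-refl
  downFrom-tadpole (suc l) = TadpoleOnℕ.step (tadpole-successor (3 + n) (2 + l))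
    (λ z∈ → tadpole-skip (3 + n) (∈-downFrom⁻ z∈) (s≤s (s≤s z≤n))) (downFrom-tadpole l)

  module _ {r : ℕ → ℕ → Bool} (irr : ∀ a → r a a ≡ false) (simple : IsSimpleGraph (symAdj r {3 + n})) where
    module ℕ-graph = Independence (sym-closure r) (sym-closure-sym r) (sym-closure-irr {r} irr)

    indepCoeff-downFrom : ∀ j → indepCoeff (symAdj r {3 + n}) j ≡ ℕ-graph.indPoly (λ _ → true) (downFrom (3 + n)) j
    indepCoeff-downFrom j = ≡.trans (indepCoeff≡indPoly (symAdj r) simple j) (≡.trans
      (indPoly-map (symAdj r) (proj₁ simple) (proj₂ simple) (sym-closure r) (sym-closure-sym r) (sym-closure-irr {r} irr)
        toℕ (λ _ _ → ≡-refl) (λ _ → true) (λ _ → true) (λ _ → ≡-refl) (allFin (3 + n)) j)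
      (ℕ-graph.indPoly-↭ (map-toℕ-↭ (3 + n)) (λ _ → true) j))

  indepCoeff-C : ∀ j → indepCoeff (C (3 + n)) j ≡ cyclePoly (3 + n) j
  indepCoeff-C j = ≡.trans (indepCoeff-downFrom {cycleArc (3 + n)} (cycleArc-irr (1 + n)) C-simple j)
    (≡.trans (CycleOnℕ.indPoly-cycle downFrom-cycle j) (cong (λ l → cyclePoly l j) (length-downFrom (3 + n))))

  indepCoeff-D : ∀ j → indepCoeff (D (3 + n)) j ≡ cyclePoly (3 + n) j
  indepCoeff-D j = ≡.trans (indepCoeff-downFrom {tadpoleArc (3 + n)} (tadpoleArc-irr (3 + n)) D-simple j)
    (≡.trans (TadpoleOnℕ.indPoly-tadpole (downFrom-tadpole n) j) (cong (λ l → cyclePoly l j) (length-downFrom (3 + n))))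

-- The equivalence class of C_n

module _ {p} (p-prime : Prime p) (p≥5 : 5 ≤ p) {n} (p∣ : ∀ j → p ∣ cyclePoly n (suc j))
         {m} (H : Graph m) (simple : IsSimpleGraph H) where
  open Structure H (proj₁ simple) (proj₂ simple)
  open Labelling H (proj₁ simple) (proj₂ simple)

  equivalence-class : 4 ≤ n → SameIndPoly H (C n) ⇔ (H ≅ C n ⊎ H ≅ D n)
  equivalence-class (s≤s (s≤s (s≤s (s≤s {n = l} _)))) = mk⇔ forward backward
    where
    classify : ∀ {S} → S ↭ allFin m → length S ≡ 4 + l → CycleList S ⊎ TadpoleList S → H ≅ C (4 + l) ⊎ H ≅ D (4 + l)
    classify {S} perm len (inj₁ cyc) = inj₁ (agrees⇒≅ H simple {R = sym-closure (cycleArc (4 + l))} {G = C (4 + l)}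
      (sym-closure-sym (cycleArc (4 + l))) (sym-closure-irr {cycleArc (4 + l)} (cycleArc-irr (2 + l))) (λ _ _ → ≡-refl)
      perm len (subst (λ k → Agrees (sym-closure (cycleArc k)) S) len (cycle-agrees cyc)))
    classify {S} perm len (inj₂ tad) = inj₂ (agrees⇒≅ H simple {R = sym-closure (tadpoleArc (4 + l))} {G = D (4 + l)}
      (sym-closure-sym (tadpoleArc (4 + l))) (sym-closure-irr {tadpoleArc (4 + l)} (tadpoleArc-irr (4 + l))) (λ _ _ → ≡-refl)
      perm len (tadpole-agrees (4 + l) tad))
    forward : SameIndPoly H (C (4 + l)) → H ≅ C (4 + l) ⊎ H ≅ D (4 + l)
    forward same = let S , perm , listed = same⇒listed p-prime p≥5 (allFin m) p∣ same′ in
      classify perm (≡.trans (↭-length perm) (same⇒length (allFin m) l same′)) listed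
      where
      open Global H (proj₁ simple) (proj₂ simple)
      same′ : ∀ j → Independence.indPoly H (proj₁ simple) (proj₂ simple) (λ _ → true) (allFin m) j ≡ cyclePoly (4 + l) j
      same′ j = ≡.trans (sym (indepCoeff≡indPoly H simple j)) (≡.trans (same j) (indepCoeff-C (1 + l) j))
    backward : H ≅ C (4 + l) ⊎ H ≅ D (4 + l) → SameIndPoly H (C (4 + l))
    backward (inj₁ iso) = ≅⇒SameIndPoly {G = C (4 + l)} simple (C-simple (1 + l)) iso
    backward (inj₂ iso) j = ≡.trans (≅⇒SameIndPoly {G = D (4 + l)} simple (D-simple (1 + l)) iso j)
      (≡.trans (indepCoeff-D (1 + l) j) (sym (indepCoeff-C (1 + l) j)))

theorem19 : (k p : ℕ) → 1 ≤ k → Prime p → 5 ≤ p →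
    ∀ {m} (H : Graph m) → IsSimpleGraph H →
    SameIndPoly H (C (p ^ k)) ⇔ (H ≅ C (p ^ k) ⊎ H ≅ D (p ^ k))
theorem19 k@(suc i) p _ p-prime 5≤p H simple =
  equivalence-class p-prime 5≤p (∣cyclePoly p-prime k (≤-trans (n≤1+n 3) 4≤p^k)) H simple 4≤p^k
  where
  instance _ = prime⇒nonZero p-prime
  4≤p^k : 4 ≤ p ^ k
  4≤p^k = ≤-trans (≤-trans (n≤1+n 4) 5≤p) (m≤m*n p (p ^ i) {{m^n≢0 p i}})
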